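{- Let $s$ and $m$ be real constants such that $sm>0$, and such that $m$ is a positive integer if $s>0$. For each integer $n\ge 1$ let $F_n$ denote the (finite) set of ordered trees with $n$ vertices, and give each ordered tree $T$ the weight $$w(T)=\prod_{v\in T}\binom{m}{d_v}s^{d_v},$$ where $d_v$ is the number of children of the vertex $v$ in $T$. Let $h_v$ be the hook length of $v$ in $T$, i.e. the number of descendants of $v$ in $T$, including $v$ itself. Then for every $n=1,2,\ldots$, $$\sum_{T\in F_n}w(T)\prod_{v\in T}\frac{1}{h_v m^{h_v-1}}=\frac{s^{n-1}}{n!}$$ and $$\sum_{T\in F_n}w(T)\prod_{v\in T}\frac{(z+h_v)^{h_v-1}}{h_v(mz+h_v-1)^{h_v-2}}=\frac{s^{n-1}m^n z}{n!}(z+n)^{n-1},$$ where the second equality is an identity of rational functions in the variable $z$.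
   Context: An ordered tree is a finite (unlabelled) rooted tree in which a linear ordering is specified for the children of each vertex; two such trees are identified if they are isomorphic as rooted trees by an isomorphism preserving the orderings of children. Products $\prod_{v\in T}$ run over all vertices $v$ of $T$. The descendants of $v$ are the vertices $u$ such that $v$ lies on the path from the root to $u$. For a real number $m$ and integer $d\ge 0$, $\binom{m}{d}=\frac{m(m-1)\cdots(m-d+1)}{d!}$ is the generalized binomial coefficient (with $\binom{m}{0}=1$). The family of ordered trees with the weights $w(T)$ is called the binomial family, or $(s,m)$-family, and $F_n$ is its subset of trees with $n$ vertices. When $h_v=1$, the factor $(mz+h_v-1)^{h_v-2}$ in the denominator is $(mz)^{ -1}$, so the corresponding factor of the product equals $mz$. -}

module Defs where

open import Level using (Level; _⊔_) renaming (suc to lsuc)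
open import Algebra.Bundles using (CommutativeRing)
open import Algebra.Structures using (IsCommutativeRing)
open import Algebra.Apartness.Bundles using (HeytingCommutativeRing; HeytingField)
import Algebra.Apartness.Properties.HeytingCommutativeRing as HCRProperties
import Algebra.Properties.Ring as RingProperties
import Algebra.Properties.AbelianGroup as AbelianGroupProperties
import Algebra.Properties.CommutativeSemigroup as CommutativeSemigroupProperties
import Algebra.Solver.Ring.NaturalCoefficients.Default as SemiringSolver
open import Data.Nat.Base as ℕ using (ℕ; zero; suc)
open import Data.List.Base as List using (List; []; _∷_; map)
open import Data.Product.Base using (∃-syntax; _×_; _,_; proj₁; proj₂)
open import Data.Sum.Base as Sum using (_⊎_; inj₁; inj₂)
open import Data.Empty using (⊥-elim)
open import Function.Base using (_∘_)
open import Relation.Nullary.Negation using (¬_)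
open import Relation.Binary.Core using (Rel)
import Relation.Binary.Reasoning.Setoid as SetoidReasoning
open import Data.Nat.Base using (_∸_; _≤_; s≤s; s≤s⁻¹; _!)
open import Data.Nat.Properties using (suc-injective; m+n∸m≡n; m+[n∸m]≡n; m≤m+n; m∸n≤m; ≤-refl; ≤-trans)
open import Data.List.Base using (_++_; length; concatMap; upTo; cartesianProductWith; foldr)
open import Data.List.Properties using (length-++)
open import Data.List.Membership.Propositional using (_∈_)
open import Data.List.Membership.Propositional.Properties using (∈-map⁺; ∈-map⁻; ∈-concat⁺′; ∈-concat⁻′; ∈-upTo⁺; ∈-upTo⁻; ∈-cartesianProductWith⁺; ∈-cartesianProductWith⁻)
open import Data.List.Relation.Binary.Disjoint.Propositional using (Disjoint)
open import Data.List.Relation.Unary.All as All using (All; [])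
import Data.List.Relation.Unary.All.Properties as All
open import Data.List.Relation.Unary.Any using (here)
open import Data.List.Relation.Unary.AllPairs as AllPairs using ([]; _∷_)
import Data.List.Relation.Unary.AllPairs.Properties as AllPairs
open import Data.List.Relation.Unary.Unique.Propositional using (Unique)
import Data.List.Relation.Unary.Unique.Propositional.Properties as Unique
open import Function.Bundles using (_⇔_; mk⇔)
open import Relation.Binary.PropositionalEquality as ≡ using (_≡_; _≢_; cong; cong₂; subst)
import Algebra.Properties.Semiring.Exp as SemiringExp
import Algebra.Properties.Semiring.Mult as SemiringMult
open import Data.Integer.Base using (ℤ; +_; -[1+_])
open import Data.Nat.Properties using (_!≢0)
open import Function.Bundles using (module Equivalence)
open import Relation.Binary.Structures using (IsStrictPartialOrder)

-- Ordered trees up to isomorphism: an isomorphism preserving the order of the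
-- children is an equality of elements of this type.

data Tree : Set where
  node : List Tree → Tree

children : Tree → List Tree
children (node ts) = ts

-- A vertex v of T is represented by the subtree of T formed by v and its
-- descendants, so a subtree that occurs several times in T is listed several times.

vertices : Tree → List Tree
forestVertices : List Tree → List Tree
vertices (node ts) = node ts ∷ forestVertices ts
forestVertices []       = []
forestVertices (t ∷ ts) = vertices t ++ forestVertices ts

size : Tree → ℕ
size T = length (vertices T)

-- the number of children d_v and the hook length h_v of a vertex

degree : Tree → ℕ
degree v = length (children v)

hook : Tree → ℕ
hook v = length (vertices v)

hook-nonZero : ∀ v → ℕ.NonZero (hook v)
hook-nonZero (node ts) = _

-- forests fuel n lists the forests with n vertices, provided n ≤ fuel.  A nonempty
-- forest is determined by the children of the root of its first tree and by the
-- rest of the forest, which together have one vertex less.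

consTree : List Tree → List Tree → List Tree
consTree ts us = node ts ∷ us

forests : (fuel n : ℕ) → List (List Tree)
splitForests : (fuel n k : ℕ) → List (List Tree)
forests _       zero    = [] ∷ []
forests zero    (suc n) = []
forests (suc f) (suc n) = concatMap (splitForests f n) (upTo (suc n))
splitForests f n k = cartesianProductWith consTree (forests f k) (forests f (n ∸ k))

orderedTrees : ℕ → List Tree
orderedTrees zero    = []
orderedTrees (suc n) = map node (forests n n)

private
  forestSize : List Tree → ℕ
  forestSize ts = length (forestVertices ts)

  forestSize-cons : ∀ ts us → forestSize (consTree ts us) ≡ suc (forestSize ts ℕ.+ forestSize us)
  forestSize-cons ts us = cong suc (length-++ (forestVertices ts))

  consTree-injective : ∀ {ts us ts′ us′} → consTree ts us ≡ consTree ts′ us′ → ts ≡ ts′ × us ≡ us′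
  consTree-injective ≡.refl = ≡.refl , ≡.refl

  node-injective : ∀ {ts us} → node ts ≡ node us → ts ≡ us
  node-injective ≡.refl = ≡.refl

  ∈-concatMap-inverse : ∀ {A B : Set} (g : A → List B) xs {y} → y ∈ concatMap g xs → ∃[ x ] x ∈ xs × y ∈ g x
  ∈-concatMap-inverse g xs y∈
    with _ , p , q ← ∈-concat⁻′ (map g xs) y∈
    with x , x∈ , ≡.refl ← ∈-map⁻ g q = x , x∈ , p

  forests-sound : ∀ f n {ts} → ts ∈ forests f n → forestSize ts ≡ n
  forests-sound _       zero    (here ≡.refl) = ≡.refl
  forests-sound (suc f) (suc n) ts∈
    with k , k∈ , p ← ∈-concatMap-inverse (splitForests f n) (upTo (suc n)) ts∈
    with ts , us , ts∈ , us∈ , ≡.refl ← ∈-cartesianProductWith⁻ consTree (forests f k) (forests f (n ∸ k)) p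
    = ≡.trans (forestSize-cons ts us) (cong suc (≡.trans
        (cong₂ ℕ._+_ (forests-sound f k ts∈) (forests-sound f (n ∸ k) us∈))
        (m+[n∸m]≡n (s≤s⁻¹ (∈-upTo⁻ {suc n} k∈)))))

  forests-complete : ∀ f n ts → n ≤ f → forestSize ts ≡ n → ts ∈ forests f n
  forests-complete f       zero    []             _         _ = here ≡.refl
  forests-complete f       zero    (node _ ∷ _)   _         ()
  forests-complete f       (suc n) []             _         ()
  forests-complete (suc f) (suc n) (node ts ∷ us) (s≤s n≤f) e = ∈-concat⁺′
    (∈-cartesianProductWith⁺ consTree
      (forests-complete f k ts (≤-trans k≤n n≤f) ≡.refl)
      (forests-complete f (n ∸ k) us (≤-trans (m∸n≤m n k) n≤f) l≡n∸k))
    (∈-map⁺ (splitForests f n) (∈-upTo⁺ {suc n} {forestSize ts} (s≤s k≤n)))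
    where
    k = forestSize ts
    l = forestSize us
    k+l≡n : k ℕ.+ l ≡ n
    k+l≡n = suc-injective (≡.trans (≡.sym (forestSize-cons ts us)) e)
    k≤n : k ≤ n
    k≤n = subst (k ≤_) k+l≡n (m≤m+n k l)
    l≡n∸k : l ≡ n ∸ k
    l≡n∸k = ≡.trans (≡.sym (m+n∸m≡n k l)) (cong (_∸ k) k+l≡n)

  splitForests-unique : ∀ f n k → Unique (forests f k) → Unique (forests f (n ∸ k)) →
                        Unique (splitForests f n k)
  splitForests-unique f n k = Unique.cartesianProductWith⁺ consTree consTree-injective

  splitForests-disjoint : ∀ f n {j k} → j ≢ k → Disjoint (splitForests f n j) (splitForests f n k)
  splitForests-disjoint f n {j} {k} j≢k (p , q)
    with ts , us , ts∈ , _ , ≡.refl ← ∈-cartesianProductWith⁻ consTree (forests f j) (forests f (n ∸ j)) p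
    with .ts , .us , ts∈′ , _ , ≡.refl ← ∈-cartesianProductWith⁻ consTree (forests f k) (forests f (n ∸ k)) q
    = j≢k (≡.trans (≡.sym (forests-sound f j ts∈)) (forests-sound f k ts∈′))

  forests-unique : ∀ f n → Unique (forests f n)
  forests-unique _       zero    = [] ∷ []
  forests-unique zero    (suc n) = []
  forests-unique (suc f) (suc n) = Unique.concat⁺
    (All.map⁺ (All.universal (λ k → splitForests-unique f n k (forests-unique f k) (forests-unique f (n ∸ k)))
                             (upTo (suc n))))
    (AllPairs.map⁺ (AllPairs.map (splitForests-disjoint f n) (Unique.upTo⁺ (suc n))))

orderedTrees-unique : ∀ n → Unique (orderedTrees n)
orderedTrees-unique zero    = []
orderedTrees-unique (suc n) = Unique.map⁺ node-injective (forests-unique n n)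

∈-orderedTrees : ∀ n T → T ∈ orderedTrees n ⇔ size T ≡ n
∈-orderedTrees n T = mk⇔ (to n) (from n T)
  where
  to : ∀ n {T} → T ∈ orderedTrees n → size T ≡ n
  to (suc n) p with ts , ts∈ , ≡.refl ← ∈-map⁻ node p = cong suc (forests-sound n n ts∈)
  from : ∀ n T → size T ≡ n → T ∈ orderedTrees n
  from (suc n) (node ts) e = ∈-map⁺ node (forests-complete n n ts ≤-refl (suc-injective e))

-- Univariate polynomials, as lists of coefficients, constant term first.
-- Trailing zeros are not excluded, so equality is equality of all coefficients.

module Polynomial {c ℓ : Level} (R : CommutativeRing c ℓ) where

  open CommutativeRing R
  open RingProperties ring using (-0#≈0#)
  open CommutativeSemigroupProperties +-commutativeSemigroup using (interchange)

  Poly : Set c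
  Poly = List Carrier

  coeff : Poly → ℕ → Carrier
  coeff []      _       = 0#
  coeff (a ∷ p) zero    = a
  coeff (a ∷ p) (suc k) = coeff p k

  infix 4 _≈ₚ_
  record _≈ₚ_ (p q : Poly) : Set ℓ where
    constructor pointwise
    field at : ∀ k → coeff p k ≈ coeff q k
  open _≈ₚ_ public

  infixl 6 _+ₚ_
  _+ₚ_ : Poly → Poly → Poly
  []      +ₚ q       = q
  (a ∷ p) +ₚ []      = a ∷ p
  (a ∷ p) +ₚ (b ∷ q) = (a + b) ∷ (p +ₚ q)

  infixl 7 _*ₚ_
  _*ₚ_ : Poly → Poly → Poly
  []      *ₚ q = []
  (a ∷ p) *ₚ q = map (a *_) q +ₚ (0# ∷ p *ₚ q)

  infix 8 -ₚ_
  -ₚ_ : Poly → Poly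
  -ₚ_ = map (-_)

  0ₚ 1ₚ : Poly
  0ₚ = []
  1ₚ = 1# ∷ []

  coeff-+ : ∀ p q k → coeff (p +ₚ q) k ≈ coeff p k + coeff q k
  coeff-+ []      q       k       = sym (+-identityˡ _)
  coeff-+ (a ∷ p) []      k       = sym (+-identityʳ _)
  coeff-+ (a ∷ p) (b ∷ q) zero    = refl
  coeff-+ (a ∷ p) (b ∷ q) (suc k) = coeff-+ p q k

  coeff-scale : ∀ a p k → coeff (map (a *_) p) k ≈ a * coeff p k
  coeff-scale a []      k       = sym (zeroʳ a)
  coeff-scale a (b ∷ p) zero    = refl
  coeff-scale a (b ∷ p) (suc k) = coeff-scale a p k

  coeff-neg : ∀ p k → coeff (-ₚ p) k ≈ - coeff p k
  coeff-neg []      k       = sym -0#≈0#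
  coeff-neg (b ∷ p) zero    = refl
  coeff-neg (b ∷ p) (suc k) = coeff-neg p k

  ≈ₚ-refl : ∀ {p} → p ≈ₚ p
  ≈ₚ-refl .at k = refl

  ≈ₚ-sym : ∀ {p q} → p ≈ₚ q → q ≈ₚ p
  ≈ₚ-sym e .at k = sym (at e k)

  ≈ₚ-trans : ∀ {p q r} → p ≈ₚ q → q ≈ₚ r → p ≈ₚ r
  ≈ₚ-trans e f .at k = trans (at e k) (at f k)

  private
    X : Poly → Poly
    X p = 0# ∷ p

    scale : Carrier → Poly → Poly
    scale a = map (a *_)

    ∷-cong : ∀ {a b p q} → a ≈ b → p ≈ₚ q → (a ∷ p) ≈ₚ (b ∷ q)
    ∷-cong e f .at zero    = e
    ∷-cong e f .at (suc k) = at f k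

    scale-cong : ∀ {a b p q} → a ≈ b → p ≈ₚ q → scale a p ≈ₚ scale b q
    scale-cong {a} {b} {p} {q} e f .at k =
      trans (coeff-scale a p k) (trans (*-cong e (at f k)) (sym (coeff-scale b q k)))

    X-zero : X [] ≈ₚ []
    X-zero .at zero    = refl
    X-zero .at (suc k) = refl

  +ₚ-cong : ∀ {p q r t} → p ≈ₚ q → r ≈ₚ t → p +ₚ r ≈ₚ q +ₚ t
  +ₚ-cong {p} {q} {r} {t} e f .at k =
    trans (coeff-+ p r k) (trans (+-cong (at e k) (at f k)) (sym (coeff-+ q t k)))

  -ₚ-cong : ∀ {p q} → p ≈ₚ q → -ₚ p ≈ₚ -ₚ q
  -ₚ-cong {p} {q} e .at k =
    trans (coeff-neg p k) (trans (-‿cong (at e k)) (sym (coeff-neg q k)))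

  +ₚ-assoc : ∀ p q r → (p +ₚ q) +ₚ r ≈ₚ p +ₚ (q +ₚ r)
  +ₚ-assoc p q r .at k = begin
    coeff ((p +ₚ q) +ₚ r) k               ≈⟨ coeff-+ (p +ₚ q) r k ⟩
    coeff (p +ₚ q) k + coeff r k          ≈⟨ +-congʳ (coeff-+ p q k) ⟩
    (coeff p k + coeff q k) + coeff r k   ≈⟨ +-assoc _ _ _ ⟩
    coeff p k + (coeff q k + coeff r k)   ≈⟨ +-congˡ (coeff-+ q r k) ⟨
    coeff p k + coeff (q +ₚ r) k          ≈⟨ coeff-+ p (q +ₚ r) k ⟨
    coeff (p +ₚ (q +ₚ r)) k               ∎
    where open SetoidReasoning setoid

  +ₚ-comm : ∀ p q → p +ₚ q ≈ₚ q +ₚ p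
  +ₚ-comm p q .at k = trans (coeff-+ p q k) (trans (+-comm _ _) (sym (coeff-+ q p k)))

  +ₚ-identityˡ : ∀ p → 0ₚ +ₚ p ≈ₚ p
  +ₚ-identityˡ p = ≈ₚ-refl

  +ₚ-identityʳ : ∀ p → p +ₚ 0ₚ ≈ₚ p
  +ₚ-identityʳ p = +ₚ-comm p 0ₚ

  -ₚ-inverseʳ : ∀ p → p +ₚ (-ₚ p) ≈ₚ 0ₚ
  -ₚ-inverseʳ p .at k =
    trans (coeff-+ p (-ₚ p) k) (trans (+-congˡ (coeff-neg p k)) (-‿inverseʳ _))

  -ₚ-inverseˡ : ∀ p → (-ₚ p) +ₚ p ≈ₚ 0ₚ
  -ₚ-inverseˡ p = ≈ₚ-trans (+ₚ-comm (-ₚ p) p) (-ₚ-inverseʳ p)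

  private
    X-+ : ∀ p q → X (p +ₚ q) ≈ₚ X p +ₚ X q
    X-+ p q = ∷-cong (sym (+-identityˡ 0#)) ≈ₚ-refl

    scale-X : ∀ a p → scale a (X p) ≈ₚ X (scale a p)
    scale-X a p = ∷-cong (zeroʳ a) ≈ₚ-refl

    scale-distribˡ : ∀ a p q → scale a (p +ₚ q) ≈ₚ scale a p +ₚ scale a q
    scale-distribˡ a p q .at k = begin
      coeff (scale a (p +ₚ q)) k               ≈⟨ coeff-scale a (p +ₚ q) k ⟩
      a * coeff (p +ₚ q) k                     ≈⟨ *-congˡ (coeff-+ p q k) ⟩
      a * (coeff p k + coeff q k)              ≈⟨ distribˡ _ _ _ ⟩
      a * coeff p k + a * coeff q k            ≈⟨ +-cong (coeff-scale a p k) (coeff-scale a q k) ⟨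
      coeff (scale a p) k + coeff (scale a q) k ≈⟨ coeff-+ (scale a p) (scale a q) k ⟨
      coeff (scale a p +ₚ scale a q) k         ∎
      where open SetoidReasoning setoid

    scale-scale : ∀ a b p → scale (a * b) p ≈ₚ scale a (scale b p)
    scale-scale a b p .at k = begin
      coeff (scale (a * b) p) k       ≈⟨ coeff-scale (a * b) p k ⟩
      a * b * coeff p k               ≈⟨ *-assoc _ _ _ ⟩
      a * (b * coeff p k)             ≈⟨ *-congˡ (coeff-scale b p k) ⟨
      a * coeff (scale b p) k         ≈⟨ coeff-scale a (scale b p) k ⟨
      coeff (scale a (scale b p)) k   ∎
      where open SetoidReasoning setoid

    scale-zero : ∀ p → scale 0# p ≈ₚ []
    scale-zero p .at k = trans (coeff-scale 0# p k) (zeroˡ _)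

    scale-one : ∀ p → scale 1# p ≈ₚ p
    scale-one p .at k = trans (coeff-scale 1# p k) (*-identityˡ _)

    +ₚ-interchange : ∀ p q r t → (p +ₚ q) +ₚ (r +ₚ t) ≈ₚ (p +ₚ r) +ₚ (q +ₚ t)
    +ₚ-interchange p q r t .at k = begin
      coeff ((p +ₚ q) +ₚ (r +ₚ t)) k                          ≈⟨ lem p q r t ⟩
      (coeff p k + coeff q k) + (coeff r k + coeff t k)       ≈⟨ interchange _ _ _ _ ⟩
      (coeff p k + coeff r k) + (coeff q k + coeff t k)       ≈⟨ lem p r q t ⟨
      coeff ((p +ₚ r) +ₚ (q +ₚ t)) k                          ∎
      where
      open SetoidReasoning setoid
      lem : ∀ p q r t → coeff ((p +ₚ q) +ₚ (r +ₚ t)) k ≈ (coeff p k + coeff q k) + (coeff r k + coeff t k)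
      lem p q r t = trans (coeff-+ (p +ₚ q) (r +ₚ t) k) (+-cong (coeff-+ p q k) (coeff-+ r t k))

    +ₚ-swap : ∀ p q r → p +ₚ (q +ₚ r) ≈ₚ q +ₚ (p +ₚ r)
    +ₚ-swap p q r =
      ≈ₚ-trans (≈ₚ-sym (+ₚ-assoc p q r)) (≈ₚ-trans (+ₚ-cong (+ₚ-comm p q) ≈ₚ-refl) (+ₚ-assoc q p r))

  *ₚ-congˡ : ∀ p {q r} → q ≈ₚ r → p *ₚ q ≈ₚ p *ₚ r
  *ₚ-congˡ []      e = ≈ₚ-refl
  *ₚ-congˡ (a ∷ p) e = +ₚ-cong (scale-cong refl e) (∷-cong refl (*ₚ-congˡ p e))

  *ₚ-zeroʳ : ∀ p → p *ₚ 0ₚ ≈ₚ 0ₚ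
  *ₚ-zeroʳ []      = ≈ₚ-refl
  *ₚ-zeroʳ (a ∷ p) = ≈ₚ-trans (∷-cong refl (*ₚ-zeroʳ p)) X-zero

  *ₚ-∷ : ∀ p b q → p *ₚ (b ∷ q) ≈ₚ map (b *_) p +ₚ (0# ∷ p *ₚ q)
  *ₚ-∷ []      b q = ≈ₚ-sym X-zero
  *ₚ-∷ (a ∷ p) b q = ∷-cong (+-congʳ (*-comm a b)) (≈ₚ-trans
    (+ₚ-cong ≈ₚ-refl (*ₚ-∷ p b q))
    (+ₚ-swap (scale a q) (scale b p) (X (p *ₚ q))))

  *ₚ-comm : ∀ p q → p *ₚ q ≈ₚ q *ₚ p
  *ₚ-comm []      q = ≈ₚ-sym (*ₚ-zeroʳ q)
  *ₚ-comm (a ∷ p) q =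
    ≈ₚ-trans (+ₚ-cong ≈ₚ-refl (∷-cong refl (*ₚ-comm p q))) (≈ₚ-sym (*ₚ-∷ q a p))

  *ₚ-cong : ∀ {p q r t} → p ≈ₚ q → r ≈ₚ t → p *ₚ r ≈ₚ q *ₚ t
  *ₚ-cong {p} {q} {r} {t} e f = ≈ₚ-trans (*ₚ-congˡ p f)
    (≈ₚ-trans (*ₚ-comm p t) (≈ₚ-trans (*ₚ-congˡ t e) (*ₚ-comm t q)))

  *ₚ-distribˡ : ∀ p q r → p *ₚ (q +ₚ r) ≈ₚ p *ₚ q +ₚ p *ₚ r
  *ₚ-distribˡ []      q r = ≈ₚ-refl
  *ₚ-distribˡ (a ∷ p) q r = ≈ₚ-trans
    (+ₚ-cong (scale-distribˡ a q r) (≈ₚ-trans (∷-cong refl (*ₚ-distribˡ p q r)) (X-+ (p *ₚ q) (p *ₚ r))))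
    (+ₚ-interchange (scale a q) (scale a r) (X (p *ₚ q)) (X (p *ₚ r)))

  *ₚ-distribʳ : ∀ p q r → (q +ₚ r) *ₚ p ≈ₚ q *ₚ p +ₚ r *ₚ p
  *ₚ-distribʳ p q r = ≈ₚ-trans (*ₚ-comm (q +ₚ r) p)
    (≈ₚ-trans (*ₚ-distribˡ p q r) (+ₚ-cong (*ₚ-comm p q) (*ₚ-comm p r)))

  private
    scale-*ₚ : ∀ a p q → scale a p *ₚ q ≈ₚ scale a (p *ₚ q)
    scale-*ₚ a []      q = ≈ₚ-refl
    scale-*ₚ a (b ∷ p) q = ≈ₚ-trans
      (+ₚ-cong (scale-scale a b q) (≈ₚ-trans (∷-cong refl (scale-*ₚ a p q)) (≈ₚ-sym (scale-X a (p *ₚ q)))))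
      (≈ₚ-sym (scale-distribˡ a (scale b q) (X (p *ₚ q))))

  *ₚ-assoc : ∀ p q r → (p *ₚ q) *ₚ r ≈ₚ p *ₚ (q *ₚ r)
  *ₚ-assoc []      q r = ≈ₚ-refl
  *ₚ-assoc (a ∷ p) q r = ≈ₚ-trans (*ₚ-distribʳ r (scale a q) (X (p *ₚ q)))
    (+ₚ-cong (scale-*ₚ a q r)
             (+ₚ-cong (scale-zero r) (∷-cong refl (*ₚ-assoc p q r))))

  *ₚ-identityˡ : ∀ p → 1ₚ *ₚ p ≈ₚ p
  *ₚ-identityˡ p = ≈ₚ-trans (+ₚ-cong (scale-one p) X-zero) (+ₚ-identityʳ p)

  *ₚ-identityʳ : ∀ p → p *ₚ 1ₚ ≈ₚ p
  *ₚ-identityʳ p = ≈ₚ-trans (*ₚ-comm p 1ₚ) (*ₚ-identityˡ p)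

  polynomialRing : CommutativeRing c ℓ
  polynomialRing = record
    { Carrier = Poly
    ; _≈_ = _≈ₚ_
    ; _+_ = _+ₚ_
    ; _*_ = _*ₚ_
    ; -_  = -ₚ_
    ; 0#  = 0ₚ
    ; 1#  = 1ₚ
    ; isCommutativeRing = record
      { isRing = record
        { +-isAbelianGroup = record
          { isGroup = record
            { isMonoid = record
              { isSemigroup = record
                { isMagma = record
                  { isEquivalence = record { refl = ≈ₚ-refl ; sym = ≈ₚ-sym ; trans = ≈ₚ-trans }
                  ; ∙-cong = +ₚ-cong
                  }
                ; assoc = +ₚ-assoc
                }
              ; identity = +ₚ-identityˡ , +ₚ-identityʳ
              }
            ; inverse = -ₚ-inverseˡ , -ₚ-inverseʳ
            ; ⁻¹-cong = -ₚ-cong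
            }
          ; comm = +ₚ-comm
          }
        ; *-cong = *ₚ-cong
        ; *-assoc = *ₚ-assoc
        ; *-identity = *ₚ-identityˡ , *ₚ-identityʳ
        ; distrib = *ₚ-distribˡ , *ₚ-distribʳ
        }
      ; *-comm = *ₚ-comm
      }
    }

module FieldProperties {c ℓ₁ ℓ₂ : Level} (F : HeytingField c ℓ₁ ℓ₂) where

  open HeytingField F
  open HCRProperties heytingCommutativeRing public using (1#0; x#0y#0→xy#0; #-congʳ; #-congˡ; x-0≈x)
  private
    CR : CommutativeRing c ℓ₁
    CR = HeytingCommutativeRing.commutativeRing heytingCommutativeRing
    open module CR = CommutativeRing CR using (ring; +-abelianGroup; +-commutativeSemigroup)
  open RingProperties ring using (-‿distribʳ-*)
  open AbelianGroupProperties +-abelianGroup using (⁻¹-∙-comm)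
  open CommutativeSemigroupProperties +-commutativeSemigroup using (interchange)

  -- An element is apart from 0 exactly when it is invertible.

  #-resp : ∀ {x y u v} → x ≈ u → y ≈ v → x # y → u # v
  #-resp e f = #-congˡ f ∘ #-congʳ e

  #0-inverse : ∀ {x} → x # 0# → ∃[ y ] x * y ≈ 1#
  #0-inverse {x} x#0 with y , _ , e ← #⇒invertible x#0 = y , trans (*-congʳ (sym (x-0≈x x))) e

  inverse-#0 : ∀ {x y} → x * y ≈ 1# → x # 0#
  inverse-#0 {x} {y} e = invertible⇒#
    (y , trans (*-congˡ (x-0≈x x)) (trans (*-comm y x) e) , trans (*-congʳ (x-0≈x x)) e)

  #⇒-#0 : ∀ {x y} → x # y → x - y # 0#
  #⇒-#0 x#y with z , _ , e ← #⇒invertible x#y = inverse-#0 e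

  -#0⇒# : ∀ {x y} → x - y # 0# → x # y
  -#0⇒# d#0 with z , e ← #0-inverse d#0 = invertible⇒# (z , trans (*-comm z _) e , e)

  *-#0ˡ : ∀ {x y} → x * y # 0# → x # 0#
  *-#0ˡ {x} {y} xy#0 with z , e ← #0-inverse xy#0 = inverse-#0 (trans (sym (*-assoc x y z)) e)

  *-#0ʳ : ∀ {x y} → x * y # 0# → y # 0#
  *-#0ʳ {x} {y} xy#0 = *-#0ˡ (#-congʳ (*-comm x y) xy#0)

  private
    -‿+-interchange : ∀ x y u v → (x + y) - (u + v) ≈ (x - u) + (y - v)
    -‿+-interchange x y u v = trans (+-congˡ (sym (⁻¹-∙-comm u v))) (interchange x y (- u) (- v))

  +-cancelʳ-# : ∀ {x y} z → x + z # y + z → x # y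
  +-cancelʳ-# {x} {y} z p = -#0⇒# (#-congʳ
    (trans (-‿+-interchange x z y z) (trans (+-congˡ (-‿inverseʳ z)) (+-identityʳ _)))
    (#⇒-#0 p))

  +-cancelˡ-# : ∀ {x y} z → z + x # z + y → x # y
  +-cancelˡ-# z p = +-cancelʳ-# z (#-resp (+-comm z _) (+-comm z _) p)

  +-strong-# : ∀ {x y u v} → x + y # u + v → x # u ⊎ y # v
  +-strong-# {x} {y} {u} {v} p with #-cotrans p (u + y)
  ... | inj₁ q = inj₁ (+-cancelʳ-# y q)
  ... | inj₂ q = inj₂ (+-cancelˡ-# u q)

  +-#0 : ∀ {x y} → x + y # 0# → x # 0# ⊎ y # 0#
  +-#0 p = +-strong-# (#-congˡ (sym (+-identityˡ 0#)) p)

  *-cancelˡ-# : ∀ {x y} a → a * x # a * y → x # y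
  *-cancelˡ-# {x} {y} a p = -#0⇒# (*-#0ʳ (#-congʳ
    (trans (+-congˡ (-‿distribʳ-* a y)) (sym (distribˡ a x (- y)))) (#⇒-#0 p)))

  ¬#⇒≈ : ∀ {x y} → ¬ x # y → x ≈ y
  ¬#⇒≈ = proj₁ (tight _ _)

-- The field F(z) of rational functions over a field F, as fractions of polynomials.

module RationalFunctions {c ℓ₁ ℓ₂ : Level} (F : HeytingField c ℓ₁ ℓ₂) where

  private
    module F = HeytingField F
    module FP = FieldProperties F
    commutativeRing : CommutativeRing c ℓ₁
    commutativeRing = HeytingCommutativeRing.commutativeRing F.heytingCommutativeRing

  open Polynomial commutativeRing public
  private
    module P = CommutativeRing polynomialRing
    module PR = RingProperties P.ring

  infix 4 _#ₚ_
  record _#ₚ_ (p q : Poly) : Set ℓ₂ where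
    constructor apart
    field
      index    : ℕ
      apart-at : coeff p index F.# coeff q index

  #ₚ-resp : ∀ {p q r t} → p ≈ₚ r → q ≈ₚ t → p #ₚ q → r #ₚ t
  #ₚ-resp e f (apart k p) = apart k (FP.#-resp (at e k) (at f k) p)

  #ₚ-irrefl : ∀ {p q} → p ≈ₚ q → ¬ p #ₚ q
  #ₚ-irrefl e (apart k p) = F.#-irrefl (at e k) p

  #ₚ-sym : ∀ {p q} → p #ₚ q → q #ₚ p
  #ₚ-sym (apart k p) = apart k (F.#-sym p)

  #ₚ-cotrans : ∀ {p q} → p #ₚ q → ∀ r → p #ₚ r ⊎ r #ₚ q
  #ₚ-cotrans (apart k p) r with F.#-cotrans p (coeff r k)
  ... | inj₁ l = inj₁ (apart k l)
  ... | inj₂ l = inj₂ (apart k l)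

  ¬#ₚ⇒≈ₚ : ∀ {p q} → ¬ p #ₚ q → p ≈ₚ q
  ¬#ₚ⇒≈ₚ n .at k = FP.¬#⇒≈ λ l → n (apart k l)

  #ₚ⇒-#ₚ0 : ∀ {p q} → p #ₚ q → p +ₚ -ₚ q #ₚ 0ₚ
  #ₚ⇒-#ₚ0 {p} {q} (apart k l) = apart k (FP.#-congʳ
    (F.sym (F.trans (coeff-+ p (-ₚ q) k) (F.+-congˡ (coeff-neg q k)))) (FP.#⇒-#0 l))

  -#ₚ0⇒#ₚ : ∀ {p q} → p +ₚ -ₚ q #ₚ 0ₚ → p #ₚ q
  -#ₚ0⇒#ₚ {p} {q} (apart k l) = apart k (FP.-#0⇒# (FP.#-congʳ
    (F.trans (coeff-+ p (-ₚ q) k) (F.+-congˡ (coeff-neg q k))) l))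

  *ₚ-cancelˡ-# : ∀ f {p q} → f *ₚ p #ₚ f *ₚ q → p #ₚ q
  *ₚ-cancelˡ-# []      (apart k l) = ⊥-elim (F.#-irrefl F.refl l)
  *ₚ-cancelˡ-# (a ∷ f) {p} {q} (apart k l)
    with FP.+-strong-# (FP.#-resp (coeff-+ (map (a F.*_) p) _ k) (coeff-+ (map (a F.*_) q) _ k) l)
  ... | inj₁ m = apart k (FP.*-cancelˡ-# a (FP.#-resp (coeff-scale a p k) (coeff-scale a q k) m))
  *ₚ-cancelˡ-# (a ∷ f) (apart zero    l) | inj₂ m = ⊥-elim (F.#-irrefl F.refl m)
  *ₚ-cancelˡ-# (a ∷ f) (apart (suc k) l) | inj₂ m = *ₚ-cancelˡ-# f (apart k m)

  *ₚ-cancelʳ-# : ∀ f {p q} → p *ₚ f #ₚ q *ₚ f → p #ₚ q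
  *ₚ-cancelʳ-# f {p} {q} = *ₚ-cancelˡ-# f ∘ #ₚ-resp (*ₚ-comm p f) (*ₚ-comm q f)

  *ₚ-#0ˡ : ∀ {p q} → p *ₚ q #ₚ 0ₚ → p #ₚ 0ₚ
  *ₚ-#0ˡ {p} {q} = *ₚ-cancelʳ-# q

  *ₚ-#0ʳ : ∀ {p q} → p *ₚ q #ₚ 0ₚ → q #ₚ 0ₚ
  *ₚ-#0ʳ {p} {q} = *ₚ-#0ˡ {q} {p} ∘ #ₚ-resp (*ₚ-comm p q) ≈ₚ-refl

  private
    -- if the lowest coefficient of p is nonzero and q ≠ 0 then pq ≠ 0
    low-#0 : ∀ a p q → a F.# F.0# → q #ₚ 0ₚ → (a ∷ p) *ₚ q #ₚ 0ₚ
    low-#0 a p (b ∷ q) a#0 (apart zero b#0) =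
      apart zero (FP.#-congʳ (F.sym (F.+-identityʳ _)) (FP.x#0y#0→xy#0 a#0 b#0))
    low-#0 a p (b ∷ q) a#0 (apart (suc k) q#0) with apart j l ← low-#0 a p q a#0 (apart k q#0)
      with F.#-cotrans l (coeff ((a ∷ p) *ₚ (b ∷ q)) (suc j))
    ... | inj₂ m = apart (suc j) m
    ... | inj₁ m
      with FP.+-strong-# (FP.#-resp (F.sym (F.+-identityˡ _))
             (F.trans (at (*ₚ-∷ (a ∷ p) b q) (suc j))
                      (coeff-+ (map (b F.*_) (a ∷ p)) (F.0# ∷ (a ∷ p) *ₚ q) (suc j))) m)
    ... | inj₂ n = ⊥-elim (F.#-irrefl F.refl n)
    ... | inj₁ n = apart zero (FP.#-congʳ (F.sym (F.+-identityʳ _)) (FP.x#0y#0→xy#0 a#0 b#0))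
      where
      b#0 : b F.# F.0#
      b#0 = FP.*-#0ˡ (FP.#-congʳ (coeff-scale b p j) (F.#-sym n))
    low-#0 a p [] a#0 (apart k l) = ⊥-elim (F.#-irrefl F.refl l)

  *ₚ-#0 : ∀ {p q} → p #ₚ 0ₚ → q #ₚ 0ₚ → p *ₚ q #ₚ 0ₚ
  *ₚ-#0 {[]}    {q} (apart k l)       q#0 = ⊥-elim (F.#-irrefl F.refl l)
  *ₚ-#0 {a ∷ p} {q} (apart zero l)    q#0 = low-#0 a p q l q#0
  *ₚ-#0 {a ∷ p} {q} (apart (suc k) l) q#0 with apart j m ← *ₚ-#0 {p} {q} (apart k l) q#0
    with F.#-cotrans m (coeff ((a ∷ p) *ₚ q) (suc j))
  ... | inj₂ n = apart (suc j) n
  ... | inj₁ n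
    with FP.+-strong-# (FP.#-resp (F.sym (F.+-identityˡ _)) (coeff-+ (map (a F.*_) q) _ (suc j)) n)
  ... | inj₂ o = ⊥-elim (F.#-irrefl F.refl o)
  ... | inj₁ o = low-#0 a p q (FP.*-#0ˡ (FP.#-congʳ (coeff-scale a q (suc j)) (F.#-sym o))) q#0

  *ₚ-mono-# : ∀ {p q f} → p #ₚ q → f #ₚ 0ₚ → p *ₚ f #ₚ q *ₚ f
  *ₚ-mono-# {p} {q} {f} p#q f#0 = -#ₚ0⇒#ₚ {p *ₚ f} {q *ₚ f} (#ₚ-resp
    (P.trans (*ₚ-distribʳ f p (-ₚ q)) (+ₚ-cong (≈ₚ-refl {p *ₚ f}) (P.sym (PR.-‿distribˡ-* q f)))) ≈ₚ-refl
    (*ₚ-#0 (#ₚ⇒-#ₚ0 p#q) f#0))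

  *ₚ-cancelʳ : ∀ {p q f} → f #ₚ 0ₚ → p *ₚ f ≈ₚ q *ₚ f → p ≈ₚ q
  *ₚ-cancelʳ f#0 e = ¬#ₚ⇒≈ₚ λ p#q → #ₚ-irrefl e (*ₚ-mono-# p#q f#0)

  record Fraction : Set (c ⊔ ℓ₂) where
    constructor fraction
    field
      num   : Poly
      den   : Poly
      den#0 : den #ₚ 0ₚ
  open Fraction public

  infix 4 _≈ᶠ_ _#ᶠ_
  record _≈ᶠ_ (x y : Fraction) : Set ℓ₁ where
    constructor cross
    field uncross : num x *ₚ den y ≈ₚ num y *ₚ den x
  open _≈ᶠ_ public

  record _#ᶠ_ (x y : Fraction) : Set ℓ₂ where
    constructor cross#
    field uncross# : num x *ₚ den y #ₚ num y *ₚ den x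
  open _#ᶠ_ public

  1ₚ#0 : 1ₚ #ₚ 0ₚ
  1ₚ#0 = apart 0 FP.1#0

  ⟨_⟩ : Poly → Fraction
  ⟨ p ⟩ = fraction p 1ₚ 1ₚ#0

  infixl 6 _+ᶠ_
  infixl 7 _*ᶠ_
  infix  8 -ᶠ_

  _+ᶠ_ _*ᶠ_ : Fraction → Fraction → Fraction
  x +ᶠ y = fraction (num x *ₚ den y +ₚ num y *ₚ den x) (den x *ₚ den y) (*ₚ-#0 (den#0 x) (den#0 y))
  x *ᶠ y = fraction (num x *ₚ num y) (den x *ₚ den y) (*ₚ-#0 (den#0 x) (den#0 y))

  -ᶠ_ : Fraction → Fraction
  -ᶠ x = fraction (-ₚ num x) (den x) (den#0 x)

  0ᶠ 1ᶠ : Fraction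
  0ᶠ = ⟨ 0ₚ ⟩
  1ᶠ = ⟨ 1ₚ ⟩

  open SemiringSolver P.commutativeSemiring using (solve; _:+_; _:*_; _:=_)

  ≈ᶠ-refl : ∀ {x} → x ≈ᶠ x
  ≈ᶠ-refl = cross ≈ₚ-refl

  ≈ᶠ-sym : ∀ {x y} → x ≈ᶠ y → y ≈ᶠ x
  ≈ᶠ-sym (cross e) = cross (≈ₚ-sym e)

  private
    shuffle : ∀ a b c → (a *ₚ b) *ₚ c ≈ₚ (a *ₚ c) *ₚ b
    shuffle = solve 3 (λ a b c → (a :* b) :* c := (a :* c) :* b) P.refl

  ≈ᶠ-trans : ∀ {x y z} → x ≈ᶠ y → y ≈ᶠ z → x ≈ᶠ z
  ≈ᶠ-trans {fraction a b b#0} {fraction c d d#0} {fraction e f f#0} (cross g) (cross h) =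
    cross (*ₚ-cancelʳ d#0 (begin
      (a *ₚ f) *ₚ d   ≈⟨ shuffle a f d ⟩
      (a *ₚ d) *ₚ f   ≈⟨ *ₚ-cong g ≈ₚ-refl ⟩
      (c *ₚ b) *ₚ f   ≈⟨ shuffle c b f ⟩
      (c *ₚ f) *ₚ b   ≈⟨ *ₚ-cong h ≈ₚ-refl ⟩
      (e *ₚ d) *ₚ b   ≈⟨ shuffle e d b ⟩
      (e *ₚ b) *ₚ d   ∎))
    where open SetoidReasoning P.setoid

  +ᶠ-cong : ∀ {x y u v} → x ≈ᶠ y → u ≈ᶠ v → x +ᶠ u ≈ᶠ y +ᶠ v
  +ᶠ-cong {fraction a b _} {fraction a′ b′ _} {fraction c d _} {fraction c′ d′ _} (cross e) (cross f) = cross (begin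
    (a *ₚ d +ₚ c *ₚ b) *ₚ (b′ *ₚ d′)                  ≈⟨ lem a b b′ c d d′ ⟩
    (a *ₚ b′) *ₚ (d *ₚ d′) +ₚ (c *ₚ d′) *ₚ (b *ₚ b′)  ≈⟨ +ₚ-cong (*ₚ-cong e ≈ₚ-refl) (*ₚ-cong f ≈ₚ-refl) ⟩
    (a′ *ₚ b) *ₚ (d *ₚ d′) +ₚ (c′ *ₚ d) *ₚ (b *ₚ b′)  ≈⟨ lem′ a′ b b′ c′ d d′ ⟩
    (a′ *ₚ d′ +ₚ c′ *ₚ b′) *ₚ (b *ₚ d)                ∎)
    where
    open SetoidReasoning P.setoid
    lem : ∀ a b b′ c d d′ → (a *ₚ d +ₚ c *ₚ b) *ₚ (b′ *ₚ d′) ≈ₚ (a *ₚ b′) *ₚ (d *ₚ d′) +ₚ (c *ₚ d′) *ₚ (b *ₚ b′)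
    lem = solve 6 (λ a b b′ c d d′ →
      (a :* d :+ c :* b) :* (b′ :* d′) := (a :* b′) :* (d :* d′) :+ (c :* d′) :* (b :* b′)) P.refl
    lem′ : ∀ a b b′ c d d′ → (a *ₚ b) *ₚ (d *ₚ d′) +ₚ (c *ₚ d) *ₚ (b *ₚ b′) ≈ₚ (a *ₚ d′ +ₚ c *ₚ b′) *ₚ (b *ₚ d)
    lem′ = solve 6 (λ a b b′ c d d′ →
      (a :* b) :* (d :* d′) :+ (c :* d) :* (b :* b′) := (a :* d′ :+ c :* b′) :* (b :* d)) P.refl

  private
    medial : ∀ a b c d → (a *ₚ b) *ₚ (c *ₚ d) ≈ₚ (a *ₚ c) *ₚ (b *ₚ d)
    medial = solve 4 (λ a b c d → (a :* b) :* (c :* d) := (a :* c) :* (b :* d)) P.refl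

  *ᶠ-cong : ∀ {x y u v} → x ≈ᶠ y → u ≈ᶠ v → x *ᶠ u ≈ᶠ y *ᶠ v
  *ᶠ-cong {fraction a b _} {fraction a′ b′ _} {fraction c d _} {fraction c′ d′ _} (cross e) (cross f) =
    cross (P.trans (medial a c b′ d′) (P.trans (*ₚ-cong e f) (medial a′ b c′ d)))

  -ᶠ-cong : ∀ {x y} → x ≈ᶠ y → -ᶠ x ≈ᶠ -ᶠ y
  -ᶠ-cong {fraction a b _} {fraction c d _} (cross e) = cross (P.trans
    (P.sym (PR.-‿distribˡ-* a d)) (P.trans (-ₚ-cong e) (PR.-‿distribˡ-* c b)))

  private
    same : ∀ {x y} → num x ≈ₚ num y → den x ≈ₚ den y → x ≈ᶠ y
    same e f = cross (*ₚ-cong e (≈ₚ-sym f))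

  +ᶠ-assoc : ∀ x y z → (x +ᶠ y) +ᶠ z ≈ᶠ x +ᶠ (y +ᶠ z)
  +ᶠ-assoc (fraction a b _) (fraction c d _) (fraction e f _) = same (lem a b c d e f) (*ₚ-assoc b d f)
    where
    lem : ∀ a b c d e f → (a *ₚ d +ₚ c *ₚ b) *ₚ f +ₚ e *ₚ (b *ₚ d) ≈ₚ a *ₚ (d *ₚ f) +ₚ (c *ₚ f +ₚ e *ₚ d) *ₚ b
    lem = solve 6 (λ a b c d e f →
      (a :* d :+ c :* b) :* f :+ e :* (b :* d) := a :* (d :* f) :+ (c :* f :+ e :* d) :* b) P.refl

  +ᶠ-comm : ∀ x y → x +ᶠ y ≈ᶠ y +ᶠ x
  +ᶠ-comm (fraction a b _) (fraction c d _) = same (+ₚ-comm (a *ₚ d) (c *ₚ b)) (*ₚ-comm b d)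

  +ᶠ-identityˡ : ∀ x → 0ᶠ +ᶠ x ≈ᶠ x
  +ᶠ-identityˡ (fraction a b _) = same (*ₚ-identityʳ a) (*ₚ-identityˡ b)

  +ᶠ-identityʳ : ∀ x → x +ᶠ 0ᶠ ≈ᶠ x
  +ᶠ-identityʳ x = ≈ᶠ-trans (+ᶠ-comm x 0ᶠ) (+ᶠ-identityˡ x)

  -ᶠ-inverseʳ : ∀ x → x +ᶠ -ᶠ x ≈ᶠ 0ᶠ
  -ᶠ-inverseʳ (fraction a b _) = cross (P.trans (*ₚ-identityʳ _)
    (P.trans (P.sym (*ₚ-distribʳ b a (-ₚ a))) (*ₚ-cong (-ₚ-inverseʳ a) ≈ₚ-refl)))

  -ᶠ-inverseˡ : ∀ x → -ᶠ x +ᶠ x ≈ᶠ 0ᶠ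
  -ᶠ-inverseˡ x = ≈ᶠ-trans (+ᶠ-comm (-ᶠ x) x) (-ᶠ-inverseʳ x)

  *ᶠ-assoc : ∀ x y z → (x *ᶠ y) *ᶠ z ≈ᶠ x *ᶠ (y *ᶠ z)
  *ᶠ-assoc (fraction a b _) (fraction c d _) (fraction e f _) = same (*ₚ-assoc a c e) (*ₚ-assoc b d f)

  *ᶠ-comm : ∀ x y → x *ᶠ y ≈ᶠ y *ᶠ x
  *ᶠ-comm (fraction a b _) (fraction c d _) = same (*ₚ-comm a c) (*ₚ-comm b d)

  *ᶠ-identityˡ : ∀ x → 1ᶠ *ᶠ x ≈ᶠ x
  *ᶠ-identityˡ (fraction a b _) = same (*ₚ-identityˡ a) (*ₚ-identityˡ b)

  *ᶠ-identityʳ : ∀ x → x *ᶠ 1ᶠ ≈ᶠ x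
  *ᶠ-identityʳ (fraction a b _) = same (*ₚ-identityʳ a) (*ₚ-identityʳ b)

  *ᶠ-distribˡ : ∀ x y z → x *ᶠ (y +ᶠ z) ≈ᶠ x *ᶠ y +ᶠ x *ᶠ z
  *ᶠ-distribˡ (fraction a b _) (fraction c d _) (fraction e f _) = cross (lem a b c d e f)
    where
    lem : ∀ a b c d e f → (a *ₚ (c *ₚ f +ₚ e *ₚ d)) *ₚ ((b *ₚ d) *ₚ (b *ₚ f))
                        ≈ₚ ((a *ₚ c) *ₚ (b *ₚ f) +ₚ (a *ₚ e) *ₚ (b *ₚ d)) *ₚ (b *ₚ (d *ₚ f))
    lem = solve 6 (λ a b c d e f → (a :* (c :* f :+ e :* d)) :* ((b :* d) :* (b :* f))
      := ((a :* c) :* (b :* f) :+ (a :* e) :* (b :* d)) :* (b :* (d :* f))) P.refl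

  *ᶠ-distribʳ : ∀ x y z → (y +ᶠ z) *ᶠ x ≈ᶠ y *ᶠ x +ᶠ z *ᶠ x
  *ᶠ-distribʳ x y z = ≈ᶠ-trans (*ᶠ-comm (y +ᶠ z) x)
    (≈ᶠ-trans (*ᶠ-distribˡ x y z) (+ᶠ-cong (*ᶠ-comm x y) (*ᶠ-comm x z)))

  +ᶠ-*ᶠ-isCommutativeRing : IsCommutativeRing _≈ᶠ_ _+ᶠ_ _*ᶠ_ -ᶠ_ 0ᶠ 1ᶠ
  +ᶠ-*ᶠ-isCommutativeRing = record
    { isRing = record
      { +-isAbelianGroup = record
        { isGroup = record
          { isMonoid = record
            { isSemigroup = record
              { isMagma = record
                { isEquivalence = record { refl = ≈ᶠ-refl ; sym = ≈ᶠ-sym ; trans = ≈ᶠ-trans }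
                ; ∙-cong = +ᶠ-cong
                }
              ; assoc = +ᶠ-assoc
              }
            ; identity = +ᶠ-identityˡ , +ᶠ-identityʳ
            }
          ; inverse = -ᶠ-inverseˡ , -ᶠ-inverseʳ
          ; ⁻¹-cong = -ᶠ-cong
          }
        ; comm = +ᶠ-comm
        }
      ; *-cong = *ᶠ-cong
      ; *-assoc = *ᶠ-assoc
      ; *-identity = *ᶠ-identityˡ , *ᶠ-identityʳ
      ; distrib = *ᶠ-distribˡ , *ᶠ-distribʳ
      }
    ; *-comm = *ᶠ-comm
    }

  #ᶠ-irrefl : ∀ {x y} → x ≈ᶠ y → ¬ x #ᶠ y
  #ᶠ-irrefl (cross e) (cross# l) = #ₚ-irrefl e l

  #ᶠ-sym : ∀ {x y} → x #ᶠ y → y #ᶠ x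
  #ᶠ-sym (cross# l) = cross# (#ₚ-sym l)

  #ᶠ-cotrans : ∀ {x y} → x #ᶠ y → ∀ z → x #ᶠ z ⊎ z #ᶠ y
  #ᶠ-cotrans {fraction a b b#0} {fraction c d d#0} (cross# x#y) (fraction e f f#0) = Sum.map
    (λ l → cross# (*ₚ-cancelʳ-# d {a *ₚ f} {e *ₚ b} (#ₚ-resp (shuffle a d f) ≈ₚ-refl l)))
    (λ l → cross# (*ₚ-cancelʳ-# b {e *ₚ d} {c *ₚ f} (#ₚ-resp (shuffle e b d) (shuffle c b f) l)))
    (#ₚ-cotrans (*ₚ-mono-# {a *ₚ d} {c *ₚ b} {f} x#y f#0) ((e *ₚ b) *ₚ d))

  private
    -- the numerator of x - y
    diff : ∀ a b c d → a *ₚ d +ₚ (-ₚ c) *ₚ b ≈ₚ a *ₚ d +ₚ -ₚ (c *ₚ b)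
    diff a b c d = +ₚ-cong (≈ₚ-refl {a *ₚ d}) (P.sym (PR.-‿distribˡ-* c b))

  #ᶠ⇒inverse : ∀ {x y} → x #ᶠ y → ∃[ u ] (u *ᶠ (x +ᶠ -ᶠ y) ≈ᶠ 1ᶠ × (x +ᶠ -ᶠ y) *ᶠ u ≈ᶠ 1ᶠ)
  #ᶠ⇒inverse {x@(fraction a b b#0)} {y@(fraction c d d#0)} (cross# x#y) =
    u , cross (lem (b *ₚ d) n) , cross (lem n (b *ₚ d))
    where
    n : Poly
    n = num (x +ᶠ -ᶠ y)
    u : Fraction
    u = fraction (b *ₚ d) n (#ₚ-resp (≈ₚ-sym (diff a b c d)) ≈ₚ-refl (#ₚ⇒-#ₚ0 x#y))
    lem : ∀ p q → (p *ₚ q) *ₚ 1ₚ ≈ₚ 1ₚ *ₚ (q *ₚ p)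
    lem p q = P.trans (*ₚ-identityʳ _) (P.trans (*ₚ-comm p q) (≈ₚ-sym (*ₚ-identityˡ _)))

  inverse⇒#ᶠ : ∀ {x y} → ∃[ u ] (u *ᶠ (x +ᶠ -ᶠ y) ≈ᶠ 1ᶠ × (x +ᶠ -ᶠ y) *ᶠ u ≈ᶠ 1ᶠ) → x #ᶠ y
  inverse⇒#ᶠ {fraction a b b#0} {fraction c d d#0} (fraction p q q#0 , cross e , _) =
    cross# (-#ₚ0⇒#ₚ (#ₚ-resp (diff a b c d) ≈ₚ-refl (*ₚ-#0ʳ {p}
      (#ₚ-resp (P.trans (P.sym e) (*ₚ-identityʳ _)) ≈ₚ-refl
        (*ₚ-#0 1ₚ#0 (*ₚ-#0 q#0 (*ₚ-#0 b#0 d#0)))))))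

  rationalFunctionField : HeytingField (c ⊔ ℓ₂) ℓ₁ ℓ₂
  rationalFunctionField = record
    { Carrier = Fraction
    ; _≈_ = _≈ᶠ_
    ; _#_ = _#ᶠ_
    ; _+_ = _+ᶠ_
    ; _*_ = _*ᶠ_
    ; -_  = -ᶠ_
    ; 0#  = 0ᶠ
    ; 1#  = 1ᶠ
    ; isHeytingField = record
      { isHeytingCommutativeRing = record
        { isCommutativeRing = +ᶠ-*ᶠ-isCommutativeRing
        ; isApartnessRelation = record
          { irrefl  = #ᶠ-irrefl
          ; sym     = #ᶠ-sym
          ; cotrans = #ᶠ-cotrans
          }
        ; #⇒invertible = #ᶠ⇒inverse
        ; invertible⇒# = inverse⇒#ᶠ
        }
      ; tight = λ x y → (λ n → cross (¬#ₚ⇒≈ₚ (n ∘ cross#))) , #ᶠ-irrefl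
      }
    }

  const : F.Carrier → Fraction
  const a = ⟨ a ∷ [] ⟩

  z : Fraction
  z = ⟨ F.0# ∷ F.1# ∷ [] ⟩

module FieldOperations {c ℓ₁ ℓ₂ : Level} (F : HeytingField c ℓ₁ ℓ₂) where

  open HeytingField F
  open FieldProperties F using (x#0y#0→xy#0; 1#0; #0-inverse; inverse-#0)
  private
    module CR = CommutativeRing (HeytingCommutativeRing.commutativeRing heytingCommutativeRing)

  open SemiringExp CR.semiring public using (_^_)
  open SemiringMult CR.semiring using () renaming (_×_ to _·_)

  fromℕ : ℕ → Carrier
  fromℕ n = n · 1#

  ∑ ∏ : {A : Set} → List A → (A → Carrier) → Carrier
  ∑ xs f = foldr _+_ 0# (map f xs)
  ∏ xs f = foldr _*_ 1# (map f xs)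

  NonZero : Set (c ⊔ ℓ₂)
  NonZero = ∃[ x ] x # 0#

  infixl 7 _⊗_ _/_
  infix  8 _⁻¹
  infixr 8 _^ℕ_ _^ℤ_

  _⊗_ : NonZero → NonZero → NonZero
  (x , x#0) ⊗ (y , y#0) = x * y , x#0y#0→xy#0 x#0 y#0

  _⁻¹ : NonZero → NonZero
  (x , x#0) ⁻¹ = y , inverse-#0 (trans (*-comm y x) (proj₂ (#0-inverse x#0)))
    where
    y : Carrier
    y = proj₁ (#0-inverse x#0)

  _^ℕ_ : NonZero → ℕ → NonZero
  x ^ℕ zero  = 1# , 1#0
  x ^ℕ suc n = x ⊗ x ^ℕ n

  _^ℤ_ : NonZero → ℤ → NonZero
  x ^ℤ (+ n)    = x ^ℕ n
  x ^ℤ -[1+ n ] = (x ^ℕ suc n) ⁻¹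

  _/_ : Carrier → NonZero → Carrier
  x / y = x * proj₁ (y ⁻¹)

-- The real numbers, axiomatised as a Cauchy complete Archimedean ordered field.
-- Any two models are isomorphic, and the axioms are constructive: Cauchy
-- sequences and convergence come with a modulus, and x # y means x < y or y < x.

record RealNumbers (c ℓ₁ ℓ₂ : Level) : Set (lsuc (c ⊔ ℓ₁ ⊔ ℓ₂)) where
  field
    heytingField : HeytingField c ℓ₁ ℓ₂

  open HeytingField heytingField public renaming (Carrier to ℝ)
  open FieldOperations heytingField using (fromℕ)

  infix 4 _<_
  field
    _<_                    : Rel ℝ ℓ₂
    <-isStrictPartialOrder : IsStrictPartialOrder _≈_ _<_
    #⇔<⊎>                  : ∀ x y → x # y ⇔ (x < y ⊎ y < x)
    +-monoˡ-<              : ∀ {x y} z → x < y → x + z < y + z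
    *-positive             : ∀ {x y} → 0# < x → 0# < y → 0# < x * y
    archimedean            : ∀ x → ∃[ n ] x < fromℕ n

  -- ∣ a i - a j ∣ < 1 / (k + 1) for all i, j ≥ N
  Cauchy : (ℕ → ℝ) → Set ℓ₂
  Cauchy a = ∀ k → ∃[ N ] ∀ i j → N ≤ i → N ≤ j → fromℕ (suc k) * (a i - a j) < 1#

  -- ∣ a i - l ∣ < 1 / (k + 1) for all i ≥ N
  ConvergesTo : (ℕ → ℝ) → ℝ → Set ℓ₂
  ConvergesTo a l = ∀ k → ∃[ N ] ∀ i → N ≤ i →
    fromℕ (suc k) * (a i - l) < 1# × fromℕ (suc k) * (l - a i) < 1#

  field
    complete : ∀ a → Cauchy a → ∃[ l ] ConvergesTo a l

  open IsStrictPartialOrder <-isStrictPartialOrder public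
    using (<-resp-≈) renaming (irrefl to <-irrefl; trans to <-trans)

module BinomialFamily {c ℓ₁ ℓ₂ : Level} (R : RealNumbers c ℓ₁ ℓ₂) where

  open RealNumbers R public
  open FieldOperations heytingField public
  open RationalFunctions heytingField public
  open FieldOperations rationalFunctionField public
    using ()
    renaming ( _^_ to _^ᶠ_; ∑ to ∑ᶠ; ∏ to ∏ᶠ; NonZero to NonZeroᶠ
             ; _⊗_ to _⊗ᶠ_; _^ℤ_ to _^ℤᶠ_; _/_ to _/ᶠ_ )
  open HeytingField rationalFunctionField public using () renaming (_-_ to _-ᶠ_)
  open FieldProperties heytingField using (1#0; *-#0ʳ; #-congʳ)
  private
    module CR = CommutativeRing (HeytingCommutativeRing.commutativeRing heytingCommutativeRing)
  open RingProperties CR.ring using (-‿distribˡ-*; -‿involutive)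

  0<⇒#0 : ∀ {x} → 0# < x → x # 0#
  0<⇒#0 {x} 0<x = Equivalence.from (#⇔<⊎> x 0#) (inj₂ 0<x)

  0<1 : 0# < 1#
  0<1 with Equivalence.to (#⇔<⊎> 1# 0#) 1#0
  ... | inj₂ 0<1 = 0<1
  ... | inj₁ 1<0 = proj₁ <-resp-≈ -1*-1≈1 (*-positive 0<-1 0<-1)
    where
    0<-1 : 0# < - 1#
    0<-1 = proj₁ <-resp-≈ (+-identityˡ _) (proj₂ <-resp-≈ (-‿inverseʳ 1#) (+-monoˡ-< (- 1#) 1<0))
    -1*-1≈1 : - 1# * - 1# ≈ 1#
    -1*-1≈1 = trans (sym (-‿distribˡ-* 1# (- 1#))) (trans (-‿cong (*-identityˡ _)) (-‿involutive 1#))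

  fromℕ-positive : ∀ n → 0# < fromℕ (suc n)
  fromℕ-positive zero    = proj₁ <-resp-≈ (sym (+-identityʳ 1#)) 0<1
  fromℕ-positive (suc n) = <-trans (fromℕ-positive n)
    (proj₂ <-resp-≈ (+-identityˡ _) (+-monoˡ-< (fromℕ (suc n)) 0<1))

  fromℕ-nonZero : (n : ℕ) → ℕ.NonZero n → NonZero
  fromℕ-nonZero (suc n) _ = fromℕ (suc n) , 0<⇒#0 (fromℕ-positive n)

  factorial : ℕ → NonZero
  factorial n = fromℕ-nonZero (n !) (n !≢0)

  hookNumber : Tree → NonZero
  hookNumber v = fromℕ-nonZero (hook v) (hook-nonZero v)

  fallingFactorial : ℝ → ℕ → ℝ
  fallingFactorial m zero    = 1#
  fallingFactorial m (suc d) = fallingFactorial m d * (m - fromℕ d)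

  binomial : ℝ → ℕ → ℝ
  binomial m d = fallingFactorial m d / factorial d

  weight : (s m : ℝ) → Tree → ℝ
  weight s m T = ∏ (vertices T) λ v → binomial m (degree v) * s ^ degree v

  rightFactor : (s m : ℝ) → 0# < s * m → NonZero
  rightFactor s m 0<sm = m , *-#0ʳ {s} {m} (0<⇒#0 0<sm)

  constNonZero : NonZero → NonZeroᶠ
  constNonZero (a , a#0) = const a , cross# (#ₚ-resp (≈ₚ-sym (*ₚ-identityʳ (a ∷ []))) ≈ₚ-refl (apart 0 a#0))

  -- m z + h - 1, nonzero because m is
  linear : NonZero → ℕ → NonZeroᶠ
  linear (m , m#0) h = e , cross# (#ₚ-resp (≈ₚ-sym lemma) ≈ₚ-refl
                           (apart 1 (#-congʳ (sym (*-identityʳ m)) m#0)))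
    where
    e : Fraction
    e = const m *ᶠ z +ᶠ const (fromℕ h) -ᶠ 1ᶠ
    Z H M : Poly
    Z = 0# ∷ 1# ∷ []
    H = fromℕ h ∷ []
    M = m ∷ []
    open SemiringSolver (CommutativeRing.commutativeSemiring polynomialRing) using (solve; _:+_; _:*_; _:=_; con)
    lemma : num e *ₚ 1ₚ ≈ₚ M *ₚ Z +ₚ H +ₚ -ₚ 1ₚ
    lemma = solve 4 (λ M Z H N →
      (((M :* Z) :* con 1 :+ H :* (con 1 :* con 1)) :* con 1 :+ N :* ((con 1 :* con 1) :* con 1)) :* con 1
      := M :* Z :+ H :+ N) ≈ₚ-refl M Z H (-ₚ 1ₚ)

{-# OPTIONS --safe #-}

-- Let A(x) be the generating function of the trees, each weighted by its summand,
-- and G(x) that of the forests with an additional factor b d = C(m, d) sᵈ for d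
-- trees, so that the root's hook factor relates A (n + 1) to G n.  Grafting the
-- first tree gives θ G = θ A · (Σ (d + 1) b (d + 1) Aᵈ) for θ = x d/dx, and the
-- recursion of the binomial coefficients turns this into (1 + s A) θ G = m θ (s A) G,
-- i.e. G = (1 + s A)ᵐ.  The series Σ y (y + n a)ⁿ⁻¹ xⁿ / n! for y and for m y
-- satisfy the same relation, by Abel's binomial identity, and the relation
-- determines G n from the earlier coefficients.  The first formula is a = 0,
-- the second is a = s m over the field of rational functions.

module Submission where

open import Defs
open import Data.Nat.Base using (_≤_; _∸_)
open import Data.Integer.Base using (_⊖_)
open import Data.Product.Base using (_×_; ∃-syntax)
open import Level using (Level)
open import Algebra.Bundles using (CommutativeRing)
open import Algebra.Apartness.Bundles using (HeytingCommutativeRing; HeytingField)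
import Algebra.Properties.CommutativeSemiring.Exp as Exp
import Algebra.Properties.Group as GroupProperties
import Algebra.Properties.Semiring.Mult as SemiringMult
import Algebra.Solver.Ring.NaturalCoefficients.Default as SemiringSolver
open import Data.Integer.Base using (+_; -[1+_])
open import Data.List.Base using (List; []; _∷_; _++_; map; foldr; length; concat; concatMap; upTo; cartesianProductWith)
open import Data.List.Membership.Propositional using (_∈_)
open import Data.List.Membership.Propositional.Properties using (∈-map⁺; ∈-upTo⁻)
open import Data.List.Properties using (map-cong-local; map-applyUpTo)
import Data.List.Relation.Unary.All as All
open import Data.List.Relation.Unary.Any using (here; there)
open import Data.Nat.Base as ℕ using (ℕ; zero; suc; z≤n; s≤s; s≤s⁻¹; _!)
open import Data.Nat.Properties using (≤-refl; ≤-trans; m≤n⇒m≤1+n; m∸n≤m; _!≢0)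
open import Data.Product.Base using (_,_; proj₁; proj₂)
open import Function.Base using (_∘_; id)
open import Function.Bundles using (module Equivalence)
import Relation.Binary.Reasoning.Setoid as SetoidReasoning
open import Relation.Binary.PropositionalEquality as ≡ using (_≡_)

-- Products of power series, given by coefficients, and the Euler operator.

module CauchyProduct {c ℓ : Level} (K : CommutativeRing c ℓ) where

  open CommutativeRing K
  open SemiringMult semiring using () renaming (_×_ to _·_)
  open SemiringSolver commutativeSemiring using (solve; con; _:+_; _:*_; _:=_)
  open SetoidReasoning setoid

  fromℕ : ℕ → Carrier
  fromℕ n = n · 1#

  AreReciprocals : (ℕ → Carrier) → Set ℓ
  AreReciprocals inv = ∀ n → fromℕ (suc n) * inv n ≈ 1#

  infixl 7 _⋆_
  -- Coefficients of the product of two power series. Shifting `f` in the recursion avoids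
  -- subtraction of indices and suits induction on the degree.
  _⋆_ : (f g : ℕ → Carrier) → ℕ → Carrier
  (f ⋆ g) zero    = f 0 * g 0
  (f ⋆ g) (suc n) = f 0 * g (suc n) + (f ∘ suc ⋆ g) n

  -- Unlike d/dx, this derivation keeps every coefficient in its degree.
  θ : (ℕ → Carrier) → ℕ → Carrier
  θ f n = fromℕ n * f n

  -- The bounds serve inductions in which the coefficients are known to agree only up to degree `n`.
  ⋆-cong-≤ : ∀ {f f′ g g′} n → (∀ k → k ≤ n → f k ≈ f′ k) → (∀ k → k ≤ n → g k ≈ g′ k) →
             (f ⋆ g) n ≈ (f′ ⋆ g′) n
  ⋆-cong-≤ zero    e e′ = *-cong (e 0 z≤n) (e′ 0 z≤n)
  ⋆-cong-≤ (suc n) e e′ = +-cong (*-cong (e 0 z≤n) (e′ (suc n) ≤-refl))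
    (⋆-cong-≤ n (λ k k≤n → e (suc k) (s≤s k≤n)) (λ k k≤n → e′ k (m≤n⇒m≤1+n k≤n)))

  ⋆-cong : ∀ {f f′ g g′} → (∀ k → f k ≈ f′ k) → (∀ k → g k ≈ g′ k) → ∀ n → (f ⋆ g) n ≈ (f′ ⋆ g′) n
  ⋆-cong e e′ n = ⋆-cong-≤ n (λ k _ → e k) (λ k _ → e′ k)

  ⋆-congˡ : ∀ {f g g′} → (∀ k → g k ≈ g′ k) → ∀ n → (f ⋆ g) n ≈ (f ⋆ g′) n
  ⋆-congˡ = ⋆-cong (λ _ → refl)

  ⋆-congʳ : ∀ {f f′ g} → (∀ k → f k ≈ f′ k) → ∀ n → (f ⋆ g) n ≈ (f′ ⋆ g) n
  ⋆-congʳ e = ⋆-cong e (λ _ → refl)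

  -- The definition splits off `f 0`; splitting off `g 0` instead is what commutativity rests on.
  ⋆-sucʳ : ∀ f g n → (f ⋆ g) (suc n) ≈ (f ⋆ g ∘ suc) n + f (suc n) * g 0
  ⋆-sucʳ f g zero    = refl
  ⋆-sucʳ f g (suc n) = trans (+-congˡ (⋆-sucʳ (f ∘ suc) g n)) (sym (+-assoc _ _ _))

  ⋆-comm : ∀ f g n → (f ⋆ g) n ≈ (g ⋆ f) n
  ⋆-comm f g zero    = *-comm _ _
  ⋆-comm f g (suc n) = trans (+-cong (*-comm _ _) (⋆-comm (f ∘ suc) g n))
    (trans (+-comm _ _) (sym (⋆-sucʳ g f n)))

  ⋆-distribˡ : ∀ f g h n → (f ⋆ λ k → g k + h k) n ≈ (f ⋆ g) n + (f ⋆ h) n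
  ⋆-distribˡ f g h zero    = distribˡ _ _ _
  ⋆-distribˡ f g h (suc n) = trans (+-congˡ (⋆-distribˡ (f ∘ suc) g h n))
    (solve 5 (λ a b c u v → a :* (b :+ c) :+ (u :+ v) := (a :* b :+ u) :+ (a :* c :+ v)) refl
      (f 0) (g (suc n)) (h (suc n)) ((f ∘ suc ⋆ g) n) ((f ∘ suc ⋆ h) n))

  ⋆-scaleˡ : ∀ a f g n → ((λ k → a * f k) ⋆ g) n ≈ a * (f ⋆ g) n
  ⋆-scaleˡ a f g zero    = *-assoc _ _ _
  ⋆-scaleˡ a f g (suc n) =
    trans (+-cong (*-assoc _ _ _) (⋆-scaleˡ a (f ∘ suc) g n)) (sym (distribˡ _ _ _))

  ⋆-scaleʳ : ∀ a f g n → (f ⋆ λ k → a * g k) n ≈ a * (f ⋆ g) n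
  ⋆-scaleʳ a f g n = trans (⋆-comm f _ n) (trans (⋆-scaleˡ a g f n) (*-congˡ (⋆-comm g f n)))

  ⋆-distribʳ : ∀ f g h n → ((λ k → g k + h k) ⋆ f) n ≈ (g ⋆ f) n + (h ⋆ f) n
  ⋆-distribʳ f g h n = trans (⋆-comm _ f n)
    (trans (⋆-distribˡ f g h n) (+-cong (⋆-comm f g n) (⋆-comm f h n)))

  ⋆-assoc : ∀ f g h n → ((f ⋆ g) ⋆ h) n ≈ (f ⋆ (g ⋆ h)) n
  ⋆-assoc f g h zero    = *-assoc _ _ _
  ⋆-assoc f g h (suc n) = begin
    f 0 * g 0 * h (suc n) + ((λ k → f 0 * g (suc k) + (f ∘ suc ⋆ g) k) ⋆ h) n
      ≈⟨ +-congˡ (⋆-distribʳ h _ _ n) ⟩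
    f 0 * g 0 * h (suc n) + (((λ k → f 0 * g (suc k)) ⋆ h) n + ((f ∘ suc ⋆ g) ⋆ h) n)
      ≈⟨ +-congˡ (+-cong (⋆-scaleˡ (f 0) (g ∘ suc) h n) (⋆-assoc (f ∘ suc) g h n)) ⟩
    f 0 * g 0 * h (suc n) + (f 0 * (g ∘ suc ⋆ h) n + (f ∘ suc ⋆ (g ⋆ h)) n)
      ≈⟨ solve 5 (λ a b c u v → a :* b :* c :+ (a :* u :+ v) := a :* (b :* c :+ u) :+ v) refl _ _ _ _ _ ⟩
    f 0 * (g ⋆ h) (suc n) + (f ∘ suc ⋆ (g ⋆ h)) n ∎

  ⋆-swap : ∀ f g h n → (f ⋆ (g ⋆ h)) n ≈ (g ⋆ (f ⋆ h)) n
  ⋆-swap f g h n = trans (sym (⋆-assoc f g h n))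
    (trans (⋆-congʳ (⋆-comm f g) n) (⋆-assoc g f h n))

  ⋆-suc₀ : ∀ {f} g n → f 0 ≈ 0# → (f ⋆ g) (suc n) ≈ (f ∘ suc ⋆ g) n
  ⋆-suc₀ g n e = trans (+-congʳ (trans (*-congʳ e) (zeroˡ _))) (+-identityˡ _)

  θ-zero : ∀ f → θ f 0 ≈ 0#
  θ-zero f = zeroˡ _

  θ-⋆ : ∀ f g n → θ (f ⋆ g) n ≈ (θ f ⋆ g) n + (f ⋆ θ g) n
  θ-⋆ f g zero    = solve 2 (λ a b → con 0 :* (a :* b) := con 0 :* a :* b :+ a :* (con 0 :* b)) refl (f 0) (g 0)
  θ-⋆ f g (suc n) = begin
    (1# + N) * (f 0 * g (suc n) + (f ∘ suc ⋆ g) n)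
      ≈⟨ solve 4 (λ N a b u → (con 1 :+ N) :* (a :* b :+ u) := a :* ((con 1 :+ N) :* b) :+ (u :+ N :* u)) refl N _ _ _ ⟩
    f 0 * ((1# + N) * g (suc n)) + ((f ∘ suc ⋆ g) n + N * (f ∘ suc ⋆ g) n)
      ≈⟨ +-congˡ (+-congˡ (θ-⋆ (f ∘ suc) g n)) ⟩
    f 0 * ((1# + N) * g (suc n)) + ((f ∘ suc ⋆ g) n + ((θ (f ∘ suc) ⋆ g) n + (f ∘ suc ⋆ θ g) n))
      ≈⟨ solve 4 (λ x u v w → x :+ (u :+ (v :+ w)) := (u :+ v) :+ (x :+ w)) refl _ _ _ _ ⟩
    ((f ∘ suc ⋆ g) n + (θ (f ∘ suc) ⋆ g) n) + (f ⋆ θ g) (suc n)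
      ≈⟨ +-congʳ (⋆-distribʳ g (f ∘ suc) (θ (f ∘ suc)) n) ⟨
    ((λ k → f (suc k) + θ (f ∘ suc) k) ⋆ g) n + (f ⋆ θ g) (suc n)
      -- The extra copy of `f ∘ suc` is absorbed here: after the shift its indices are one too low
      -- for `θ f`.
      ≈⟨ +-congʳ (⋆-congʳ (λ k → solve 2 (λ N a → (a :+ N :* a) := (con 1 :+ N) :* a) refl (fromℕ k) (f (suc k))) n) ⟩
    (θ f ∘ suc ⋆ g) n + (f ⋆ θ g) (suc n)
      ≈⟨ +-congʳ (⋆-suc₀ {θ f} g n (θ-zero f)) ⟨
    (θ f ⋆ g) (suc n) + (f ⋆ θ g) (suc n) ∎
    where N = fromℕ n

-- Abel's binomial identity.

module AbelIdentity {c ℓ : Level} (K : CommutativeRing c ℓ)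
  (inv : ℕ → CommutativeRing.Carrier K) (inv-inverse : CauchyProduct.AreReciprocals K inv) where

  open CommutativeRing K
  open CauchyProduct K
  open SemiringSolver commutativeSemiring using (solve; con; _:+_; _:*_; _:=_)
  open SetoidReasoning setoid
  open GroupProperties +-group using (∙-cancelʳ)

  -- Recovers a coefficient of positive degree from its image under `θ`.
  cancel-suc : ∀ n {x y} → fromℕ (suc n) * x ≈ fromℕ (suc n) * y → x ≈ y
  cancel-suc n {x} {y} e = trans (sym (undo x)) (trans (*-congˡ e) (undo y))
    where
    undo : ∀ x → inv n * (fromℕ (suc n) * x) ≈ x
    undo x = trans (sym (*-assoc _ _ _))
      (trans (*-congʳ (trans (*-comm _ _) (inv-inverse n))) (*-identityˡ x))

  -- tⁿ / n!
  e : ℕ → Carrier → Carrier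
  e zero    t = 1#
  e (suc n) t = inv n * t * e n t

  e-cong : ∀ n {t u} → t ≈ u → e n t ≈ e n u
  e-cong zero    t≈u = refl
  e-cong (suc n) t≈u = *-cong (*-congˡ t≈u) (e-cong n t≈u)

  θe : ∀ n t → fromℕ (suc n) * e (suc n) t ≈ t * e n t
  θe n t = begin
    fromℕ (suc n) * (inv n * t * e n t) ≈⟨ solve 4 (λ N i t x → N :* (i :* t :* x) := (N :* i) :* (t :* x)) refl _ _ _ _ ⟩
    fromℕ (suc n) * inv n * (t * e n t) ≈⟨ *-congʳ (inv-inverse n) ⟩
    1# * (t * e n t)                    ≈⟨ *-identityˡ _ ⟩
    t * e n t                           ∎

  module _ (a : Carrier) where

    -- (x + na)ⁿ / n!  and the Abel polynomial x (x + na)ⁿ⁻¹ / n!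
    h p : Carrier → ℕ → Carrier
    h x n = e n (x + fromℕ n * a)
    p x zero    = 1#
    p x (suc n) = inv n * x * h (x + a) n

    private
      step : ∀ x n → x + fromℕ (suc n) * a ≈ x + a + fromℕ n * a
      step x n = solve 3 (λ x a N → x :+ (con 1 :+ N) :* a := x :+ a :+ N :* a) refl x a (fromℕ n)

    -- The index cancels `inv n`, so that `θ` turns an Abel sequence into a shifted `h`, to which
    -- `abel` applies.
    θp : ∀ x n → θ (p x) (suc n) ≈ x * h (x + a) n
    θp x n = begin
      fromℕ (suc n) * (inv n * x * y) ≈⟨ solve 4 (λ N i x y → N :* (i :* x :* y) := N :* i :* (x :* y)) refl _ _ _ _ ⟩
      fromℕ (suc n) * inv n * (x * y) ≈⟨ *-congʳ (inv-inverse n) ⟩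
      1# * (x * y)                    ≈⟨ *-identityˡ _ ⟩
      x * y                           ∎
      where y = h (x + a) n

    θh : ∀ x n → θ (h x) (suc n) ≈ (x + a + fromℕ n * a) * h (x + a) n
    θh x n = trans (θe n _) (*-cong (step x n) (e-cong n (step x n)))

    -- One factor of the power is split into `x` and `(n + 1) a`; in the second part `n + 1` cancels
    -- `inv n` and the degree drops.
    h-suc : ∀ x n → h x (suc n) ≈ p x (suc n) + a * h (x + a) n
    h-suc x n = begin
      inv n * (x + N * a) * e n (x + N * a)    ≈⟨ *-congˡ (e-cong n (step x n)) ⟩
      inv n * (x + N * a) * y                  ≈⟨ solve 5 (λ i x N a y → i :* (x :+ N :* a) :* y := i :* x :* y :+ N :* i :* (a :* y)) refl (inv n) x N a y ⟩
      inv n * x * y + N * inv n * (a * y)      ≈⟨ +-congˡ (trans (*-congʳ (inv-inverse n)) (*-identityˡ _)) ⟩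
      inv n * x * y + a * y                    ∎
      where
      N = fromℕ (suc n)
      y = h (x + a) n

    p-* : ∀ x n → (x + fromℕ n * a) * p x n ≈ x * h x n
    p-* x zero    = solve 2 (λ x a → (x :+ con 0 :* a) :* con 1 := x :* con 1) refl x a
    p-* x (suc n) = begin
      t * (inv n * x * h (x + a) n)  ≈⟨ *-congˡ (*-congˡ (e-cong n (step x n))) ⟨
      t * (inv n * x * e n t)        ≈⟨ solve 4 (λ t i x y → t :* (i :* x :* y) := x :* (i :* t :* y)) refl t (inv n) x (e n t) ⟩
      x * (inv n * t * e n t)        ∎
      where t = x + fromℕ (suc n) * a

    hh-suc : ∀ x y n → (h x ⋆ h y) (suc n) ≈ (p x ⋆ h y) (suc n) + a * (h (x + a) ⋆ h y) n
    hh-suc x y n = begin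
      1# * h y (suc n) + (h x ∘ suc ⋆ h y) n
        ≈⟨ +-congˡ (⋆-congʳ (h-suc x) n) ⟩
      1# * h y (suc n) + ((λ k → p x (suc k) + a * h (x + a) k) ⋆ h y) n
        ≈⟨ +-congˡ (trans (⋆-distribʳ (h y) _ _ n) (+-congˡ (⋆-scaleˡ a _ (h y) n))) ⟩
      1# * h y (suc n) + ((p x ∘ suc ⋆ h y) n + a * (h (x + a) ⋆ h y) n)
        ≈⟨ +-assoc _ _ _ ⟨
      (p x ⋆ h y) (suc n) + a * (h (x + a) ⋆ h y) n ∎

    θp-⋆ : ∀ x g n → (θ (p x) ⋆ g) (suc n) ≈ x * (h (x + a) ⋆ g) n
    θp-⋆ x g n = begin
      (θ (p x) ⋆ g) (suc n)       ≈⟨ ⋆-suc₀ {θ (p x)} g n (θ-zero (p x)) ⟩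
      (θ (p x) ∘ suc ⋆ g) n       ≈⟨ ⋆-congʳ (θp x) n ⟩
      ((λ k → x * h (x + a) k) ⋆ g) n ≈⟨ ⋆-scaleˡ x _ g n ⟩
      x * (h (x + a) ⋆ g) n       ∎

    -- The terms of the two products combine by
    -- (y + (l + 1) a) + (x + k a) = x + (y + a) + n a  for k + l = n.
    p-⋆-θh : ∀ x y n → (p x ⋆ θ (h y)) (suc n) + x * (h x ⋆ h (y + a)) n
                     ≈ (x + (y + a) + fromℕ n * a) * (p x ⋆ h (y + a)) n
    p-⋆-θh x y n = begin
      (P ⋆ θ (h y)) (suc n) + x * (h x ⋆ H) n
        ≈⟨ +-cong (trans (⋆-comm P (θ (h y)) (suc n)) (trans (⋆-suc₀ {θ (h y)} P n (θ-zero (h y))) (⋆-comm (θ (h y) ∘ suc) P n)))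
                  (trans (sym (⋆-scaleˡ x (h x) H n)) (⋆-congʳ (λ k → sym (p-* x k)) n)) ⟩
      (P ⋆ θ (h y) ∘ suc) n + ((λ k → (x + fromℕ k * a) * P k) ⋆ H) n
        ≈⟨ +-cong (⋆-congˡ (λ k → trans (θh y k) (split (y + a) k (H k))) n) (⋆-congʳ (λ k → split x k (P k)) n) ⟩
      (P ⋆ λ k → (y + a) * H k + a * θ H k) n + ((λ k → x * P k + a * θ P k) ⋆ H) n
        ≈⟨ +-cong (trans (⋆-distribˡ P _ _ n) (+-cong (⋆-scaleʳ (y + a) P H n) (⋆-scaleʳ a P (θ H) n)))
                  (trans (⋆-distribʳ H _ _ n) (+-cong (⋆-scaleˡ x P H n) (⋆-scaleˡ a (θ P) H n))) ⟩
      ((y + a) * Q + a * (P ⋆ θ H) n) + (x * Q + a * (θ P ⋆ H) n)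
        ≈⟨ solve 6 (λ b a x Q u v → (b :* Q :+ a :* u) :+ (x :* Q :+ a :* v) := (x :+ b) :* Q :+ a :* (v :+ u)) refl (y + a) a x Q _ _ ⟩
      (x + (y + a)) * Q + a * ((θ P ⋆ H) n + (P ⋆ θ H) n)
        ≈⟨ +-congˡ (*-congˡ (θ-⋆ P H n)) ⟨
      (x + (y + a)) * Q + a * (fromℕ n * Q)
        ≈⟨ solve 4 (λ b a N Q → b :* Q :+ a :* (N :* Q) := (b :+ N :* a) :* Q) refl (x + (y + a)) a (fromℕ n) Q ⟩
      (x + (y + a) + fromℕ n * a) * Q ∎
      where
      P H : ℕ → Carrier
      P = p x
      H = h (y + a)
      Q : Carrier
      Q = (P ⋆ H) n
      split : ∀ b k u → (b + fromℕ k * a) * u ≈ b * u + a * (fromℕ k * u)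
      split b k u = solve 4 (λ b N a u → (b :+ N :* a) :* u := b :* u :+ a :* (N :* u)) refl b (fromℕ k) a u

    -- Mutual induction: degree `n + 1` here uses both statements in degree `n`, while `hh-shift` in
    -- degree `n + 1` uses `abel` in that same degree. After multiplication by `n + 1`, the Leibniz
    -- rule produces the two products of `h`s that `hh-shift` identifies.
    abel : ∀ n x y → (p x ⋆ h y) n ≈ e n (x + y + fromℕ n * a)
    -- By `hh-suc`, each side is an Abel convolution, which by `abel` depends only on the sum of the
    -- arguments, plus `a` times an instance one degree lower.
    hh-shift : ∀ n x y → (h (x + a) ⋆ h y) n ≈ (h x ⋆ h (y + a)) n

    abel zero    x y = *-identityˡ 1#
    -- `D` is the extra summand on the left of `p-⋆-θh`; adding it to both sides avoids a
    -- subtraction.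
    abel (suc n) x y = cancel-suc n (∙-cancelʳ (x * (h x ⋆ h (y + a)) n) _ _ (begin
      N * (p x ⋆ h y) (suc n) + D
        ≈⟨ +-congʳ (θ-⋆ (p x) (h y) (suc n)) ⟩
      (θ (p x) ⋆ h y) (suc n) + (p x ⋆ θ (h y)) (suc n) + D
        ≈⟨ trans (+-assoc _ _ _) (+-cong (θp-⋆ x (h y) n) (p-⋆-θh x y n)) ⟩
      x * (h (x + a) ⋆ h y) n + (x + (y + a) + fromℕ n * a) * (p x ⋆ h (y + a)) n
        ≈⟨ +-cong (*-congˡ (hh-shift n x y)) (*-congˡ (abel n x (y + a))) ⟩
      D + (x + (y + a) + fromℕ n * a) * e n (x + (y + a) + fromℕ n * a)
        ≈⟨ trans (+-comm _ _) (+-congʳ (*-cong total (e-cong n total))) ⟩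
      t * e n t + D
        ≈⟨ +-congʳ (θe n t) ⟨
      N * e (suc n) t + D ∎))
      where
      N = fromℕ (suc n)
      D = x * (h x ⋆ h (y + a)) n
      t = x + y + N * a
      total : x + (y + a) + fromℕ n * a ≈ t
      total = solve 4 (λ x y a N → x :+ (y :+ a) :+ N :* a := x :+ y :+ (con 1 :+ N) :* a) refl x y a (fromℕ n)

    hh-shift zero    x y = refl
    hh-shift (suc n) x y = begin
      (h (x + a) ⋆ h y) (suc n)
        ≈⟨ hh-suc (x + a) y n ⟩
      (p (x + a) ⋆ h y) (suc n) + a * (h (x + a + a) ⋆ h y) n
        ≈⟨ +-cong (trans (abel (suc n) (x + a) y)
                  (trans (e-cong (suc n) (+-congʳ (solve 3 (λ x y a → x :+ a :+ y := x :+ (y :+ a)) refl x y a)))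
                         (sym (abel (suc n) x (y + a)))))
                  (*-congˡ (hh-shift n (x + a) y)) ⟩
      (p x ⋆ h (y + a)) (suc n) + a * (h (x + a) ⋆ h (y + a)) n
        ≈⟨ hh-suc x (y + a) n ⟨
      (h x ⋆ h (y + a)) (suc n) ∎

    θp-⋆-p : ∀ x y n → (θ (p x) ⋆ p y) (suc n) ≈ x * e n (y + (x + a) + fromℕ n * a)
    θp-⋆-p x y n = trans (θp-⋆ x (p y) n)
      (*-congˡ (trans (⋆-comm _ (p y) n) (abel n y (x + a))))

    -- With C = Σ p x n tⁿ and B = Σ p (mx) n tⁿ this says C B′ = m C′ B, i.e. B = Cᵐ.
    abel-power : ∀ m x n → (p x ⋆ θ (p (m * x))) n ≈ m * (θ (p x) ⋆ p (m * x)) n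
    abel-power m x zero    = solve 1 (λ m → con 1 :* (con 0 :* con 1) := m :* (con 0 :* con 1 :* con 1)) refl m
    abel-power m x (suc n) = begin
      (p x ⋆ θ (p (m * x))) (suc n)
        -- With `θ` on the left factor, `θp-⋆-p` evaluates both sides; the results contain the same
        -- power and differ only in the leading `m * x` and `x`.
        ≈⟨ ⋆-comm (p x) _ (suc n) ⟩
      (θ (p (m * x)) ⋆ p x) (suc n)
        ≈⟨ θp-⋆-p (m * x) x n ⟩
      m * x * e n (x + (m * x + a) + fromℕ n * a)
        ≈⟨ trans (*-assoc _ _ _) (*-congˡ (*-congˡ (e-cong n (+-congʳ
             (solve 3 (λ x w a → x :+ (w :+ a) := w :+ (x :+ a)) refl x (m * x) a))))) ⟩
      m * (x * e n (m * x + (x + a) + fromℕ n * a))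
        ≈⟨ *-congˡ (θp-⋆-p x (m * x) n) ⟨
      m * (θ (p x) ⋆ p (m * x)) (suc n) ∎

-- Fuel only secures termination. The recursion in `forests` passes the same fuel to both pieces,
-- whereas `forestSum` and `treeSum` take it equal to the size.
forests-fuel : ∀ {f f′ n} → n ≤ f → n ≤ f′ → forests f n ≡ forests f′ n
forests-fuel {n = zero}  _         _          = ≡.refl
forests-fuel {suc f} {suc f′} {suc n} (s≤s n≤f) (s≤s n≤f′) =
  ≡.cong concat (map-cong-local (All.tabulate λ {k} k∈ → let k≤n = s≤s⁻¹ (∈-upTo⁻ k∈) in
    ≡.cong₂ (cartesianProductWith consTree)
      (forests-fuel (≤-trans k≤n n≤f) (≤-trans k≤n n≤f′))
      (forests-fuel (≤-trans (m∸n≤m n k) n≤f) (≤-trans (m∸n≤m n k) n≤f′))))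

-- Finite sums and products over lists.

module Sums {c ℓ : Level} (K : CommutativeRing c ℓ) where

  open CommutativeRing K
  open CauchyProduct K using (_⋆_)
  open SemiringSolver commutativeSemiring using (solve; _:+_; _:*_; _:=_)

  private variable
    A B C : Set

  -- Spelled as in `FieldOperations`, so that over a field the two agree by definition.
  ∑ ∏ : List A → (A → Carrier) → Carrier
  ∑ xs f = foldr _+_ 0# (map f xs)
  ∏ xs f = foldr _*_ 1# (map f xs)

  ∑-cong-∈ : ∀ (xs : List A) {f g} → (∀ x → x ∈ xs → f x ≈ g x) → ∑ xs f ≈ ∑ xs g
  ∑-cong-∈ []       e = refl
  ∑-cong-∈ (x ∷ xs) e = +-cong (e x (here ≡.refl)) (∑-cong-∈ xs λ y y∈ → e y (there y∈))

  ∑-cong : ∀ (xs : List A) {f g} → (∀ x → f x ≈ g x) → ∑ xs f ≈ ∑ xs g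
  ∑-cong xs e = ∑-cong-∈ xs λ x _ → e x

  ∑-++ : ∀ (xs : List A) {ys f} → ∑ (xs ++ ys) f ≈ ∑ xs f + ∑ ys f
  ∑-++ []       = sym (+-identityˡ _)
  ∑-++ (x ∷ xs) = trans (+-congˡ (∑-++ xs)) (sym (+-assoc _ _ _))

  ∑-map : ∀ (g : A → B) xs {f} → ∑ (map g xs) f ≈ ∑ xs (f ∘ g)
  ∑-map g []       = refl
  ∑-map g (x ∷ xs) = +-congˡ (∑-map g xs)

  ∑-concatMap : ∀ (g : A → List B) xs {f} → ∑ (concatMap g xs) f ≈ ∑ xs λ x → ∑ (g x) f
  ∑-concatMap g []       = refl
  ∑-concatMap g (x ∷ xs) = trans (∑-++ (g x)) (+-congˡ (∑-concatMap g xs))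

  ∑-+ : ∀ (xs : List A) f g → ∑ xs (λ x → f x + g x) ≈ ∑ xs f + ∑ xs g
  ∑-+ []       f g = sym (+-identityˡ _)
  ∑-+ (x ∷ xs) f g = trans (+-congˡ (∑-+ xs f g))
    (solve 4 (λ a b u v → (a :+ b) :+ (u :+ v) := (a :+ u) :+ (b :+ v)) refl _ _ _ _)

  ∑-scaleˡ : ∀ (xs : List A) a f → ∑ xs (λ x → a * f x) ≈ a * ∑ xs f
  ∑-scaleˡ []       a f = sym (zeroʳ a)
  ∑-scaleˡ (x ∷ xs) a f = trans (+-congˡ (∑-scaleˡ xs a f)) (sym (distribˡ _ _ _))

  ∑-cartesianProductWith : ∀ (g : A → B → C) xs ys {f u v} → (∀ x y → f (g x y) ≈ u x * v y) →
                           ∑ (cartesianProductWith g xs ys) f ≈ ∑ xs u * ∑ ys v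
  ∑-cartesianProductWith g []       ys e = sym (zeroˡ _)
  ∑-cartesianProductWith g (x ∷ xs) ys e = trans (∑-++ (map (g x) ys))
    (trans (+-cong (trans (∑-map (g x) ys) (trans (∑-cong ys (e x)) (∑-scaleˡ ys _ _)))
                   (∑-cartesianProductWith g xs ys e))
           (sym (distribʳ _ _ _)))

  -- Links the enumeration by the size of the first part with the recursive product `⋆`.
  ∑-upTo : ∀ f g n → ∑ (upTo (suc n)) (λ k → f k * g (n ∸ k)) ≈ (f ⋆ g) n
  ∑-upTo f g zero    = +-identityʳ _
  ∑-upTo f g (suc n) = +-congˡ (trans
    -- The tail of `upTo` is `applyUpTo suc`; the shift is moved from the list into the summand.
    (reflexive (≡.cong (foldr _+_ 0#) (≡.trans (map-applyUpTo suc F (suc n)) (≡.sym (map-applyUpTo id (F ∘ suc) (suc n))))))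
    (∑-upTo (f ∘ suc) g n))
    where
    F : ℕ → Carrier
    F k = f k * g (suc n ∸ k)

  ∏-cong : ∀ (xs : List A) {f g} → (∀ x → f x ≈ g x) → ∏ xs f ≈ ∏ xs g
  ∏-cong []       e = refl
  ∏-cong (x ∷ xs) e = *-cong (e x) (∏-cong xs e)

  ∏-++ : ∀ (xs : List A) {ys f} → ∏ (xs ++ ys) f ≈ ∏ xs f * ∏ ys f
  ∏-++ []       = sym (*-identityˡ _)
  ∏-++ (x ∷ xs) = trans (*-congˡ (∏-++ xs)) (sym (*-assoc _ _ _))

  ∏-* : ∀ (xs : List A) f g → ∏ xs (λ x → f x * g x) ≈ ∏ xs f * ∏ xs g
  ∏-* []       f g = sym (*-identityˡ _)
  ∏-* (x ∷ xs) f g = trans (*-congˡ (∏-* xs f g))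
    (solve 4 (λ a b u v → (a :* b) :* (u :* v) := (a :* u) :* (b :* v)) refl _ _ _ _)

-- Generating functions of weighted trees and forests.

module TreeSums {c ℓ : Level} (K : CommutativeRing c ℓ) (b φ : ℕ → CommutativeRing.Carrier K) where

  open CommutativeRing K
  open CauchyProduct K
  open Sums K
  open SemiringSolver commutativeSemiring using (solve; con; _:+_; _:*_; _:=_)
  open SetoidReasoning setoid

  vertexFactor : Tree → Carrier
  vertexFactor v = b (degree v) * φ (hook v)

  treeValue : Tree → Carrier
  treeValue T = ∏ (vertices T) vertexFactor

  forestValue : List Tree → Carrier
  forestValue ts = ∏ (forestVertices ts) vertexFactor

  treeSum : ℕ → Carrier
  treeSum n = ∑ (orderedTrees n) treeValue

  -- `g` stays arbitrary because removing the first tree of a forest replaces it by `g ∘ suc`.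
  forestSum : (ℕ → Carrier) → ℕ → Carrier
  forestSum g n = ∑ (forests n n) λ ts → g (length ts) * forestValue ts

  -- All these trees have `n + 1` vertices, so the root's hook factor is constant, and the root's
  -- degree is the number of trees in the forest below it.
  treeSum-suc : ∀ n → treeSum (suc n) ≈ φ (suc n) * forestSum b n
  treeSum-suc n = begin
    ∑ (map node (forests n n)) treeValue      ≈⟨ ∑-map node (forests n n) ⟩
    ∑ (forests n n) (λ ts → treeValue (node ts))
      ≈⟨ ∑-cong-∈ (forests n n) (λ ts ts∈ → trans (*-assoc _ _ _)
           (trans (*-congˡ (*-congʳ (reflexive (≡.cong φ (size-node ts∈)))))
             (solve 3 (λ x y z → x :* (y :* z) := y :* (x :* z)) refl _ _ _))) ⟩
    ∑ (forests n n) (λ ts → φ (suc n) * (b (length ts) * forestValue ts))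
      ≈⟨ ∑-scaleˡ (forests n n) _ _ ⟩
    φ (suc n) * forestSum b n ∎
    where
    size-node : ∀ {ts} → ts ∈ forests n n → size (node ts) ≡ suc n
    size-node ts∈ = Equivalence.to (∈-orderedTrees (suc n) _) (∈-map⁺ node ts∈)

  forestSum-zero : ∀ g → forestSum g 0 ≈ g 0
  forestSum-zero g = trans (+-identityʳ _) (*-identityʳ _)

  -- Splits off the first tree. In terms of series: `g(A) - g(0)` is `A` times the shifted series at
  -- `A`.
  forestSum-suc : ∀ g n → forestSum g (suc n) ≈ (treeSum ⋆ forestSum (g ∘ suc)) (suc n)
  forestSum-suc g n = begin
    ∑ (concatMap (splitForests n n) (upTo (suc n))) F
      ≈⟨ ∑-concatMap (splitForests n n) (upTo (suc n)) ⟩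
    ∑ (upTo (suc n)) (λ k → ∑ (splitForests n n k) F)
      ≈⟨ ∑-cong-∈ (upTo (suc n)) (λ k k∈ → split k (s≤s⁻¹ (∈-upTo⁻ k∈))) ⟩
    ∑ (upTo (suc n)) (λ k → treeSum (suc k) * forestSum (g ∘ suc) (n ∸ k))
      ≈⟨ ∑-upTo (treeSum ∘ suc) (forestSum (g ∘ suc)) n ⟩
    (treeSum ∘ suc ⋆ forestSum (g ∘ suc)) n
      ≈⟨ ⋆-suc₀ {treeSum} (forestSum (g ∘ suc)) n refl ⟨
    (treeSum ⋆ forestSum (g ∘ suc)) (suc n) ∎
    where
    F : List Tree → Carrier
    F ts = g (length ts) * forestValue ts
    factor : ∀ ts us → F (consTree ts us) ≈ treeValue (node ts) * (g (suc (length us)) * forestValue us)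
    factor ts us = trans (*-congˡ (∏-++ (vertices (node ts))))
      (solve 3 (λ x y z → x :* (y :* z) := y :* (x :* z)) refl _ _ _)
    split : ∀ k → k ≤ n → ∑ (splitForests n n k) F ≈ treeSum (suc k) * forestSum (g ∘ suc) (n ∸ k)
    split k k≤n
      -- Both pieces are brought to the fuel used by `treeSum` and `forestSum`.
      rewrite forests-fuel k≤n (≤-refl {k}) | forests-fuel (m∸n≤m n k) (≤-refl {n ∸ k}) =
      trans (∑-cartesianProductWith consTree (forests k k) (forests (n ∸ k) (n ∸ k)) factor)
        (*-congʳ (sym (∑-map node (forests k k))))

  forestSum-cong : ∀ {g g′} → (∀ d → g d ≈ g′ d) → ∀ n → forestSum g n ≈ forestSum g′ n
  forestSum-cong e n = ∑-cong (forests n n) λ ts → *-congʳ (e (length ts))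

  forestSum-+ : ∀ g g′ n → forestSum (λ d → g d + g′ d) n ≈ forestSum g n + forestSum g′ n
  forestSum-+ g g′ n = trans (∑-cong (forests n n) λ ts → distribʳ _ _ _) (∑-+ (forests n n) _ _)

  forestSum-scale : ∀ a g n → forestSum (λ d → a * g d) n ≈ a * forestSum g n
  forestSum-scale a g n = trans (∑-cong (forests n n) λ ts → *-assoc _ _ _) (∑-scaleˡ (forests n n) _ _)

  -- Coefficients of the derivative of Σ g d xᵈ; forestSum g is this series
  -- evaluated at the generating function of treeSum.
  δ : (ℕ → Carrier) → ℕ → Carrier
  δ g d = fromℕ (suc d) * g (suc d)

  -- Writing `g(x) = g(0) + x g₁(x)` gives `g′ = g₁ + x g₁′`, evaluated here at the tree series.
  forestSum-δ : ∀ g n → forestSum (δ g) n ≈ forestSum (g ∘ suc) n + (treeSum ⋆ forestSum (δ (g ∘ suc))) n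
  forestSum-δ g zero = begin
    forestSum (δ g) 0       ≈⟨ forestSum-zero (δ g) ⟩
    (1# + 0#) * g 1         ≈⟨ solve 2 (λ x y → (con 1 :+ con 0) :* x := x :+ con 0 :* y) refl (g 1) _ ⟩
    g 1 + 0# * forestSum (δ (g ∘ suc)) 0 ≈⟨ +-congʳ (forestSum-zero (g ∘ suc)) ⟨
    forestSum (g ∘ suc) 0 + 0# * forestSum (δ (g ∘ suc)) 0 ∎
  forestSum-δ g (suc n) = begin
    forestSum (δ g) (suc n)
      ≈⟨ forestSum-suc (δ g) n ⟩
    (treeSum ⋆ forestSum (δ g ∘ suc)) (suc n)
      ≈⟨ ⋆-congˡ {treeSum} (λ k → trans (forestSum-cong (λ d → trans (distribʳ (g (suc (suc d))) 1# (fromℕ (suc d))) (+-congʳ (*-identityˡ _))) k)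
                                        (forestSum-+ (g ∘ suc ∘ suc) (δ (g ∘ suc)) k)) (suc n) ⟩
    (treeSum ⋆ λ k → forestSum (g ∘ suc ∘ suc) k + forestSum (δ (g ∘ suc)) k) (suc n)
      ≈⟨ ⋆-distribˡ treeSum _ _ (suc n) ⟩
    (treeSum ⋆ forestSum (g ∘ suc ∘ suc)) (suc n) + (treeSum ⋆ forestSum (δ (g ∘ suc))) (suc n)
      ≈⟨ +-congʳ (forestSum-suc (g ∘ suc) n) ⟨
    forestSum (g ∘ suc) (suc n) + (treeSum ⋆ forestSum (δ (g ∘ suc))) (suc n) ∎

  private
    -- With `g(A) = g(0) + A g₁(A)`, the Leibniz rule leaves `A θ(g₁(A))`. Since `A` has no constant
    -- term, only lower degrees of `θ(g₁(A))` occur, and the induction hypothesis for `g₁` applies;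
    -- `forestSum-δ` reassembles `g′`. The bound `n` makes the induction cover all lower degrees.
    chainRule-≤ : ∀ n g k → k ≤ n → θ (forestSum g) k ≈ (θ treeSum ⋆ forestSum (δ g)) k
    chainRule-≤ n       g zero    _ = solve 2 (λ x y → con 0 :* x := con 0 :* con 0 :* y) refl _ _
    chainRule-≤ (suc n) g (suc k) (s≤s k≤n) = begin
      fromℕ (suc k) * forestSum g (suc k)
        ≈⟨ *-congˡ (forestSum-suc g k) ⟩
      θ (treeSum ⋆ forestSum (g ∘ suc)) (suc k)
        ≈⟨ θ-⋆ treeSum (forestSum (g ∘ suc)) (suc k) ⟩
      (θ treeSum ⋆ forestSum (g ∘ suc)) (suc k) + (treeSum ⋆ θ (forestSum (g ∘ suc))) (suc k)
        ≈⟨ +-congˡ (⋆-suc₀ {treeSum} _ k refl) ⟩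
      (θ treeSum ⋆ forestSum (g ∘ suc)) (suc k) + (treeSum ∘ suc ⋆ θ (forestSum (g ∘ suc))) k
        ≈⟨ +-congˡ (⋆-cong-≤ k (λ _ _ → refl) (λ j j≤k → chainRule-≤ n (g ∘ suc) j (≤-trans j≤k k≤n))) ⟩
      (θ treeSum ⋆ forestSum (g ∘ suc)) (suc k) + (treeSum ∘ suc ⋆ (θ treeSum ⋆ forestSum (δ (g ∘ suc)))) k
        ≈⟨ +-congˡ (trans (sym (⋆-suc₀ {treeSum} _ k refl)) (⋆-swap treeSum (θ treeSum) _ (suc k))) ⟩
      (θ treeSum ⋆ forestSum (g ∘ suc)) (suc k) + (θ treeSum ⋆ (treeSum ⋆ forestSum (δ (g ∘ suc)))) (suc k)
        ≈⟨ ⋆-distribˡ (θ treeSum) _ _ (suc k) ⟨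
      (θ treeSum ⋆ λ j → forestSum (g ∘ suc) j + (treeSum ⋆ forestSum (δ (g ∘ suc))) j) (suc k)
        ≈⟨ ⋆-congˡ {θ treeSum} (forestSum-δ g) (suc k) ⟨
      (θ treeSum ⋆ forestSum (δ g)) (suc k) ∎

  chainRule : ∀ g n → θ (forestSum g) n ≈ (θ treeSum ⋆ forestSum (δ g)) n
  chainRule g n = chainRule-≤ n g n ≤-refl

  -- `b-suc` is the differential equation `(1 + s x) B′ = s m B` of the binomial series, read off
  -- coefficientwise, so `m` may be any ring element.
  module BinomialWeights (s m : Carrier)
    (b-suc : ∀ d → fromℕ (suc d) * b (suc d) + s * (fromℕ d * b d) ≈ s * m * b d) where

    -- The series `1 + s A`.
    base : ℕ → Carrier
    base zero    = 1#
    base (suc n) = s * treeSum (suc n)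

    base-⋆ : ∀ f n → (base ⋆ f) n ≈ f n + s * (treeSum ⋆ f) n
    base-⋆ f zero    = solve 2 (λ x s → con 1 :* x := x :+ s :* (con 0 :* x)) refl (f 0) s
    base-⋆ f (suc n) = +-cong (*-identityˡ _)
      (trans (⋆-scaleˡ s (treeSum ∘ suc) f n) (*-congˡ (sym (⋆-suc₀ {treeSum} f n refl))))

    -- `θ g` vanishes at 0 and its shift is `δ g` by definition, so this is an instance of splitting
    -- off a tree.
    forestSum-θ : ∀ g n → forestSum (θ g) n ≈ (treeSum ⋆ forestSum (δ g)) n
    forestSum-θ g zero    = trans (forestSum-zero (θ g)) (trans (zeroˡ _) (sym (zeroˡ _)))
    forestSum-θ g (suc n) = forestSum-suc (θ g) n

    -- The differential equation of the binomial series, evaluated at `A`.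
    base-⋆-δb : ∀ n → (base ⋆ forestSum (δ b)) n ≈ s * m * forestSum b n
    base-⋆-δb n = begin
      (base ⋆ forestSum (δ b)) n
        ≈⟨ base-⋆ (forestSum (δ b)) n ⟩
      forestSum (δ b) n + s * (treeSum ⋆ forestSum (δ b)) n
        ≈⟨ +-congˡ (*-congˡ (forestSum-θ b n)) ⟨
      forestSum (δ b) n + s * forestSum (θ b) n
        ≈⟨ trans (forestSum-+ (δ b) (λ d → s * θ b d) n) (+-congˡ (forestSum-scale s (θ b) n)) ⟨
      forestSum (λ d → δ b d + s * θ b d) n
        ≈⟨ forestSum-cong b-suc n ⟩
      forestSum (λ d → s * m * b d) n
        ≈⟨ forestSum-scale (s * m) b n ⟩
      s * m * forestSum b n ∎

    forestSum-power : ∀ n → (base ⋆ θ (forestSum b)) n ≈ m * (θ base ⋆ forestSum b) n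
    forestSum-power n = begin
      (base ⋆ θ (forestSum b)) n
        ≈⟨ ⋆-congˡ {base} (chainRule b) n ⟩
      (base ⋆ (θ treeSum ⋆ forestSum (δ b))) n
        ≈⟨ ⋆-swap base (θ treeSum) (forestSum (δ b)) n ⟩
      (θ treeSum ⋆ (base ⋆ forestSum (δ b))) n
        ≈⟨ ⋆-congˡ {θ treeSum} base-⋆-δb n ⟩
      (θ treeSum ⋆ λ k → s * m * forestSum b k) n
        ≈⟨ ⋆-scaleʳ (s * m) (θ treeSum) (forestSum b) n ⟩
      s * m * (θ treeSum ⋆ forestSum b) n
        ≈⟨ solve 3 (λ s m x → s :* m :* x := m :* (s :* x)) refl s m _ ⟩
      m * (s * (θ treeSum ⋆ forestSum b) n)
        ≈⟨ *-congˡ (⋆-scaleˡ s (θ treeSum) (forestSum b) n) ⟨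
      m * ((λ k → s * θ treeSum k) ⋆ forestSum b) n
        ≈⟨ *-congˡ (⋆-congʳ θ-base n) ⟨
      m * (θ base ⋆ forestSum b) n ∎
      where
      θ-base : ∀ k → θ base k ≈ s * θ treeSum k
      θ-base zero    = solve 1 (λ s → con 0 :* con 1 := s :* (con 0 :* con 0)) refl s
      θ-base (suc k) = solve 3 (λ s N x → N :* (s :* x) := s :* (N :* x)) refl s (fromℕ (suc k)) _

-- Determining the tree and forest series degree by degree.

module Uniqueness {c ℓ : Level} (K : CommutativeRing c ℓ)
  (inv : ℕ → CommutativeRing.Carrier K) (inv-inverse : CauchyProduct.AreReciprocals K inv) where

  open CommutativeRing K
  open CauchyProduct K
  open AbelIdentity K inv inv-inverse
  open Sums K
  open SetoidReasoning setoid
  open GroupProperties +-group using (∙-cancelʳ)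

  private
    -- Logarithmic derivative form of `g = fᵐ`, meaningful for every ring element `m`.
    IsPower : Carrier → (f g : ℕ → Carrier) → Set ℓ
    IsPower m f g = ∀ n → (f ⋆ θ g) n ≈ m * (θ f ⋆ g) n

  -- As `f 0` is 1, degree `n + 1` of the left side is `(n + 1) g (n + 1)` plus terms in lower
  -- coefficients of `g`; as `θ f` vanishes at 0, the right side involves only lower coefficients of
  -- `g`.
  power-unique : ∀ {m f f′ g g′} → IsPower m f g → IsPower m f′ g′ → f 0 ≈ 1# →
                 ∀ n → (∀ k → k ≤ suc n → f k ≈ f′ k) → (∀ k → k ≤ n → g k ≈ g′ k) →
                 g (suc n) ≈ g′ (suc n)
  power-unique {m} {f} {f′} {g} {g′} pow pow′ f0 n f≈ g≈ =
    cancel-suc n (∙-cancelʳ ((f ∘ suc ⋆ θ g) n) _ _ (begin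
      θ g (suc n) + (f ∘ suc ⋆ θ g) n
        ≈⟨ expand f g f0 ⟨
      (f ⋆ θ g) (suc n)
        ≈⟨ trans (pow (suc n)) (*-congˡ (⋆-suc₀ {θ f} g n (θ-zero f))) ⟩
      m * (θ f ∘ suc ⋆ g) n
        ≈⟨ *-congˡ (⋆-cong-≤ n (λ k k≤n → *-congˡ (f≈ (suc k) (s≤s k≤n))) g≈) ⟩
      m * (θ f′ ∘ suc ⋆ g′) n
        ≈⟨ trans (pow′ (suc n)) (*-congˡ (⋆-suc₀ {θ f′} g′ n (θ-zero f′))) ⟨
      (f′ ⋆ θ g′) (suc n)
        ≈⟨ expand f′ g′ (trans (sym (f≈ 0 z≤n)) f0) ⟩
      θ g′ (suc n) + (f′ ∘ suc ⋆ θ g′) n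
        ≈⟨ +-congˡ (⋆-cong-≤ n (λ k k≤n → f≈ (suc k) (s≤s k≤n)) (λ k k≤n → *-congˡ (g≈ k k≤n))) ⟨
      θ g′ (suc n) + (f ∘ suc ⋆ θ g) n ∎))
    where
    expand : ∀ f g → f 0 ≈ 1# → (f ⋆ θ g) (suc n) ≈ θ g (suc n) + (f ∘ suc ⋆ θ g) n
    expand f g f0 = +-congʳ (trans (*-congʳ f0) (*-identityˡ _))

  -- The right side is `p a (s * y) (suc n)` without one factor `s`, which spares a division by `s`.
  -- The assumption on `φ` converts forest coefficients into tree coefficients. The induction
  -- alternates: forests up to `k` give trees up to `k + 1`, and these give forests of size `k + 1`
  -- by `power-unique`.
  hook-sum : ∀ b φ s m a y → b 0 ≈ 1# →
    (∀ d → fromℕ (suc d) * b (suc d) + s * (fromℕ d * b d) ≈ s * m * b d) →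
    (∀ n → φ (suc n) * p a (m * (s * y)) n ≈ inv n * y * h a (s * y + a) n) →
    ∀ n → ∑ (orderedTrees (suc n)) (λ T → ∏ (vertices T) λ v → b (degree v) * φ (hook v))
            ≈ inv n * y * h a (s * y + a) n
  hook-sum b φ s m a y b0 b-suc φ-p n = treeSum≈ n n ≤-refl (λ k k≤n → forestSum≈ n k k≤n)
    where
    open TreeSums K b φ
    open BinomialWeights s m b-suc
    C P : ℕ → Carrier
    C = p a (s * y)
    P = p a (m * (s * y))
    treeSum≈ : ∀ n k → k ≤ n → (∀ j → j ≤ n → forestSum b j ≈ P j) →
               treeSum (suc k) ≈ inv k * y * h a (s * y + a) k
    treeSum≈ n k k≤n e = trans (treeSum-suc k) (trans (*-congˡ (e k k≤n)) (φ-p k))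
    base≈ : ∀ n → (∀ j → j ≤ n → forestSum b j ≈ P j) → ∀ k → k ≤ suc n → base k ≈ C k
    base≈ n e zero    _         = refl
    base≈ n e (suc k) (s≤s k≤n) = trans (*-congˡ (treeSum≈ n k k≤n e))
      (solve 4 (λ s i y x → s :* (i :* y :* x) := i :* (s :* y) :* x) refl s (inv k) y _)
      where open SemiringSolver commutativeSemiring using (solve; _:*_; _:=_)
    forestSum≈ : ∀ n k → k ≤ n → forestSum b k ≈ P k
    forestSum≈ n       zero    _         = trans (forestSum-zero b) b0
    forestSum≈ (suc n) (suc k) (s≤s k≤n) = power-unique forestSum-power (abel-power a m (s * y)) refl k
      (base≈ k prev) prev
      where
      prev : ∀ j → j ≤ k → forestSum b j ≈ P j
      prev j j≤k = forestSum≈ n j (≤-trans j≤k k≤n)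

-- The two hook formulas over a ring with reciprocals of positive integers.

module HookFormulas {c ℓ : Level} (K : CommutativeRing c ℓ)
  (inv : ℕ → CommutativeRing.Carrier K) (inv-inverse : CauchyProduct.AreReciprocals K inv) where

  open CommutativeRing K
  open CauchyProduct K
  open Exp commutativeSemiring
  open AbelIdentity K inv inv-inverse
  open Uniqueness K inv inv-inverse
  open SemiringSolver commutativeSemiring using (solve; con; _:+_; _:*_; _:=_)
  open SetoidReasoning setoid

  ^-inverse : ∀ {x y} n → x * y ≈ 1# → x ^ n * y ^ n ≈ 1#
  ^-inverse zero    xy≈1 = *-identityʳ 1#
  ^-inverse {x} {y} (suc n) xy≈1 = trans
    (solve 4 (λ x y u v → x :* u :* (y :* v) := x :* y :* (u :* v)) refl x y _ _)
    (trans (*-cong xy≈1 (^-inverse n xy≈1)) (*-identityʳ 1#))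

  module ForWeights
    (inv! : ℕ → Carrier) (inv!-zero : inv! 0 ≈ 1#) (inv!-suc : ∀ n → inv! (suc n) ≈ inv n * inv! n)
    (b : ℕ → Carrier) (b-zero : b 0 ≈ 1#)
    (s m : Carrier) (b-suc : ∀ d → fromℕ (suc d) * b (suc d) + s * (fromℕ d * b d) ≈ s * m * b d)
    (φ : ℕ → Carrier) where

    open TreeSums K b φ using (treeSum)

    e-^ : ∀ n t → e n t ≈ inv! n * t ^ n
    e-^ zero    t = sym (trans (*-identityʳ _) inv!-zero)
    e-^ (suc n) t = begin
      inv n * t * e n t             ≈⟨ *-congˡ (e-^ n t) ⟩
      inv n * t * (inv! n * t ^ n)  ≈⟨ solve 4 (λ i t j x → i :* t :* (j :* x) := i :* j :* (t :* x)) refl (inv n) t _ _ ⟩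
      inv n * inv! n * t ^ suc n    ≈⟨ *-congʳ (inv!-suc n) ⟨
      inv! (suc n) * t ^ suc n      ∎

    e-scale : ∀ n {t} r u → t ≈ r * u → e n t ≈ inv! n * (r ^ n * u ^ n)
    e-scale n r u t≈ru = trans (e-cong n t≈ru) (trans (e-^ n (r * u)) (*-congˡ (^-distrib-* r u n)))

    -- For `a = 0` and `y = 1` the Abel sequences are those of exponentials, and the powers of `m′`
    -- in `φ` cancel the powers of `m` in the forest series.
    exponential-hookFormula : ∀ m′ → m′ * m ≈ 1# → (∀ n → φ (suc n) ≈ inv n * m′ ^ n) →
                              ∀ n → treeSum (suc n) ≈ s ^ n * inv! (suc n)
    exponential-hookFormula m′ m′m≈1 φ≈ n = begin
      treeSum (suc n)
        ≈⟨ hook-sum b φ s m 0# 1# b-zero b-suc φ-p n ⟩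
      inv n * 1# * h 0# (s * 1# + 0#) n
        ≈⟨ *-congˡ (h≈ n) ⟩
      inv n * 1# * (inv! n * s ^ n)
        ≈⟨ solve 3 (λ i j x → i :* con 1 :* (j :* x) := x :* (i :* j)) refl (inv n) (inv! n) _ ⟩
      s ^ n * (inv n * inv! n)
        ≈⟨ *-congˡ (inv!-suc n) ⟨
      s ^ n * inv! (suc n) ∎
      where
      h≈ : ∀ n → h 0# (s * 1# + 0#) n ≈ inv! n * s ^ n
      h≈ n = trans (e-cong n (solve 2 (λ s N → s :* con 1 :+ con 0 :+ N :* con 0 := s) refl s (fromℕ n))) (e-^ n s)
      p≈ : ∀ n → p 0# (m * (s * 1#)) n ≈ inv! n * (m ^ n * s ^ n)
      p≈ zero    = sym (trans (*-cong inv!-zero (*-identityʳ 1#)) (*-identityʳ 1#))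
      p≈ (suc n) = begin
        inv n * (m * (s * 1#)) * e n (m * (s * 1#) + 0# + fromℕ n * 0#)
          ≈⟨ *-congˡ (e-scale n m s (solve 3 (λ m s N → m :* (s :* con 1) :+ con 0 :+ N :* con 0 := m :* s) refl m s (fromℕ n))) ⟩
        inv n * (m * (s * 1#)) * (inv! n * (m ^ n * s ^ n))
          ≈⟨ solve 6 (λ i j m s u v → i :* (m :* (s :* con 1)) :* (j :* (u :* v)) := i :* j :* (m :* u :* (s :* v))) refl
               (inv n) (inv! n) m s _ _ ⟩
        inv n * inv! n * (m ^ suc n * s ^ suc n)
          ≈⟨ *-congʳ (inv!-suc n) ⟨
        inv! (suc n) * (m ^ suc n * s ^ suc n) ∎
      φ-p : ∀ n → φ (suc n) * p 0# (m * (s * 1#)) n ≈ inv n * 1# * h 0# (s * 1# + 0#) n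
      φ-p n = begin
        φ (suc n) * p 0# (m * (s * 1#)) n
          ≈⟨ *-cong (φ≈ n) (p≈ n) ⟩
        inv n * m′ ^ n * (inv! n * (m ^ n * s ^ n))
          ≈⟨ solve 5 (λ i u j v w → i :* u :* (j :* (v :* w)) := u :* v :* (i :* con 1 :* (j :* w))) refl (inv n) _ (inv! n) _ _ ⟩
        m′ ^ n * m ^ n * (inv n * 1# * (inv! n * s ^ n))
          ≈⟨ trans (*-congʳ (^-inverse n m′m≈1)) (*-identityˡ _) ⟩
        inv n * 1# * (inv! n * s ^ n)
          ≈⟨ *-congˡ (h≈ n) ⟨
        inv n * 1# * h 0# (s * 1# + 0#) n ∎

    -- With `a = s m` and `y = m z`, the power in `h` becomes that of `s m (z + n + 1)`, and the
    -- power in `p` that of `s m (m z + k + 1)`, whose second factor is cancelled by the hook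
    -- denominator. Here `k` is the hook length minus 2; hook length 1 is separate because its
    -- exponent is -1.
    abel-hookFormula : ∀ z (l : ℕ → Carrier) → (∀ k → l k * (m * z + fromℕ (suc k)) ≈ 1#) →
      φ 1 ≈ inv 0 * (m * z) →
      (∀ k → φ (suc (suc k)) ≈ (z + fromℕ (suc (suc k))) ^ suc k * (inv (suc k) * l k ^ k)) →
      ∀ n → treeSum (suc n) ≈ (s * m) ^ n * m * z * inv! (suc n) * (z + fromℕ (suc n)) ^ n
    abel-hookFormula z l l-inverse φ₁ φ₂ n = begin
      treeSum (suc n)
        ≈⟨ hook-sum b φ s m r (m * z) b-zero b-suc φ-p n ⟩
      inv n * (m * z) * h r (s * (m * z) + r) n
        ≈⟨ *-congˡ (h≈ n) ⟩
      inv n * (m * z) * (inv! n * (r ^ n * (z + fromℕ (suc n)) ^ n))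
        ≈⟨ solve 6 (λ i m z j u v → i :* (m :* z) :* (j :* (u :* v)) := u :* m :* z :* (i :* j) :* v) refl (inv n) m z (inv! n) _ _ ⟩
      r ^ n * m * z * (inv n * inv! n) * (z + fromℕ (suc n)) ^ n
        ≈⟨ *-congʳ (*-congˡ (inv!-suc n)) ⟨
      r ^ n * m * z * inv! (suc n) * (z + fromℕ (suc n)) ^ n ∎
      where
      r = s * m
      L : ℕ → Carrier
      L k = m * z + fromℕ (suc k)
      h≈ : ∀ n → h r (s * (m * z) + r) n ≈ inv! n * (r ^ n * (z + fromℕ (suc n)) ^ n)
      h≈ n = e-scale n r (z + fromℕ (suc n)) (solve 4 (λ s m z N →
        s :* (m :* z) :+ s :* m :+ N :* (s :* m) := s :* m :* (z :+ (con 1 :+ N))) refl s m z (fromℕ n))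
      φ-p : ∀ n → φ (suc n) * p r (m * (s * (m * z))) n ≈ inv n * (m * z) * h r (s * (m * z) + r) n
      φ-p zero    = *-congʳ φ₁
      φ-p (suc k) = begin
        φ (suc (suc k)) * (inv k * w * e k (w + r + fromℕ k * r))
          ≈⟨ *-cong (φ₂ k) (*-congˡ (e-scale k r (L k) (solve 4 (λ s m z N →
               m :* (s :* (m :* z)) :+ s :* m :+ N :* (s :* m) := s :* m :* (m :* z :+ (con 1 :+ N))) refl s m z (fromℕ k)))) ⟩
        Z * (inv (suc k) * l k ^ k) * (inv k * w * (inv! k * (r ^ k * L k ^ k)))
          -- The factor `w` contributes the additional `s * m` that raises `r ^ k` to `r ^ suc k`.
          ≈⟨ solve 10 (λ Z i u j s m z q R v →
               Z :* (i :* u) :* (j :* (m :* (s :* (m :* z))) :* (q :* (R :* v)))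
                 := u :* v :* (i :* (m :* z) :* (j :* q :* (s :* m :* R :* Z)))) refl
               Z (inv (suc k)) (l k ^ k) (inv k) s m z (inv! k) (r ^ k) (L k ^ k) ⟩
        l k ^ k * L k ^ k * (inv (suc k) * (m * z) * (inv k * inv! k * (r ^ suc k * Z)))
          ≈⟨ trans (*-congʳ (^-inverse k (l-inverse k))) (*-identityˡ _) ⟩
        inv (suc k) * (m * z) * (inv k * inv! k * (r ^ suc k * Z))
          ≈⟨ *-congˡ (trans (h≈ (suc k)) (*-congʳ (inv!-suc k))) ⟨
        inv (suc k) * (m * z) * h r (s * (m * z) + r) (suc k) ∎
        where
        w = m * (s * (m * z))
        Z = (z + fromℕ (suc (suc k))) ^ suc k

-- Reciprocals in a Heyting field.

module Division {c ℓ₁ ℓ₂ : Level} (F : HeytingField c ℓ₁ ℓ₂) where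

  open FieldOperations F
  open CommutativeRing (HeytingCommutativeRing.commutativeRing (HeytingField.heytingCommutativeRing F)) hiding (zero)
  open FieldProperties F using (#0-inverse)
  open SemiringSolver commutativeSemiring using (solve; _:*_; _:=_)

  opaque
    -- Opaque, so that comparing terms does not unfold inverses and apartness proofs.
    recip : NonZero → Carrier
    recip x = proj₁ (x ⁻¹)

    recip-inverse : ∀ x → proj₁ x * recip x ≈ 1#
    recip-inverse (x , x#0) = proj₂ (#0-inverse x#0)

    recip≈⁻¹ : ∀ y → proj₁ (y ⁻¹) ≈ recip y
    recip≈⁻¹ y = refl

    /≈*recip : ∀ x y → x / y ≈ x * recip y
    /≈*recip x y = refl

  -- Inverses are unique; the rules for reciprocals of products, powers and inverses all reduce to
  -- this.
  recip-unique : ∀ x {y} → proj₁ x * y ≈ 1# → recip x ≈ y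
  recip-unique x {y} e = trans (sym (*-identityʳ _)) (trans (*-congˡ (sym e))
    (trans (sym (*-assoc _ _ _)) (trans (*-congʳ (trans (*-comm _ _) (recip-inverse x))) (*-identityˡ y))))

  recip-cong : ∀ x y → proj₁ x ≈ proj₁ y → recip x ≈ recip y
  recip-cong x y e = recip-unique x (trans (*-congʳ e) (recip-inverse y))

  recip-⊗ : ∀ x y → recip (x ⊗ y) ≈ recip x * recip y
  recip-⊗ x y = recip-unique (x ⊗ y) (trans
    (solve 4 (λ x y u v → x :* y :* (u :* v) := x :* u :* (y :* v)) refl (proj₁ x) (proj₁ y) _ _)
    (trans (*-cong (recip-inverse x) (recip-inverse y)) (*-identityʳ 1#)))

  recip-^ℕ : ∀ x n → recip (x ^ℕ n) ≈ recip x ^ n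
  recip-^ℕ x zero    = recip-unique (x ^ℕ zero) (*-identityʳ 1#)
  recip-^ℕ x (suc n) = trans (recip-⊗ x (x ^ℕ n)) (*-congˡ (recip-^ℕ x n))

  recip-⁻¹ : ∀ x → recip (x ⁻¹) ≈ proj₁ x
  recip-⁻¹ x = recip-unique (x ⁻¹) (trans (*-congʳ (recip≈⁻¹ x)) (trans (*-comm _ _) (recip-inverse x)))

  recip-^ℤ-neg : ∀ x {i} → i ≡ -[1+ 0 ] → recip (x ^ℤ i) ≈ proj₁ x
  recip-^ℤ-neg x ≡.refl = trans (recip-⁻¹ (x ^ℕ 1)) (*-identityʳ _)

  recip-^ℤ-pos : ∀ x n {i} → i ≡ + n → recip (x ^ℤ i) ≈ recip x ^ n
  recip-^ℤ-pos x n ≡.refl = recip-^ℕ x n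

-- Factorials and binomial weights over the reals.

module RealWeights {c ℓ₁ ℓ₂ : Level} (R : RealNumbers c ℓ₁ ℓ₂) where

  open BinomialFamily R
  ring : CommutativeRing c ℓ₁
  ring = HeytingCommutativeRing.commutativeRing (HeytingField.heytingCommutativeRing heytingField)
  open CommutativeRing ring using (semiring; commutativeSemiring)
  open SemiringMult semiring using (×1-homo-*)
  open SemiringSolver commutativeSemiring using (solve; con; _:+_; _:*_; _:=_)
  open SetoidReasoning setoid
  open Division heytingField

  inv : ℕ → ℝ
  inv n = recip (fromℕ-nonZero (suc n) _)

  inv! : ℕ → ℝ
  inv! n = recip (factorial n)

  -- `fromℕ-nonZero` matches on its argument and is therefore stuck on a factorial.
  fromℕ-nonZero-value : ∀ n n≢0 → proj₁ (fromℕ-nonZero n n≢0) ≡ fromℕ n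
  fromℕ-nonZero-value (suc n) _ = ≡.refl

  inv-inverse : ∀ n → fromℕ (suc n) * inv n ≈ 1#
  inv-inverse n = recip-inverse (fromℕ-nonZero (suc n) _)

  inv!-zero : inv! 0 ≈ 1#
  inv!-zero = recip-unique (factorial 0) (solve 0 ((con 1 :+ con 0) :* con 1 := con 1) refl)

  inv!-suc : ∀ n → inv! (suc n) ≈ inv n * inv! n
  inv!-suc n = begin
    inv! (suc n)    ≈⟨ recip-cong (factorial (suc n)) (fromℕ-nonZero (suc n) _ ⊗ factorial n) factorial-suc ⟩
    recip (fromℕ-nonZero (suc n) _ ⊗ factorial n) ≈⟨ recip-⊗ (fromℕ-nonZero (suc n) _) (factorial n) ⟩
    inv n * inv! n  ∎
    where
    factorial-suc : proj₁ (factorial (suc n)) ≈ fromℕ (suc n) * proj₁ (factorial n)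
    factorial-suc rewrite fromℕ-nonZero-value (suc n !) (suc n !≢0) | fromℕ-nonZero-value (n !) (n !≢0) =
      ×1-homo-* (suc n) (n !)

  degreeWeight : (s m : ℝ) → ℕ → ℝ
  degreeWeight s m d = binomial m d * s ^ d

  degreeWeight-zero : ∀ s m → degreeWeight s m 0 ≈ 1#
  degreeWeight-zero s m = 
    trans (*-identityʳ _) (trans (/≈*recip 1# (factorial 0)) (trans (*-identityˡ _) inv!-zero))

  -- The recursion `(d + 1) C(m, d + 1) = (m - d) C(m, d)`, with the term in `d` moved to the left.
  degreeWeight-suc : ∀ s m d →
    fromℕ (suc d) * degreeWeight s m (suc d) + s * (fromℕ d * degreeWeight s m d) ≈ s * m * degreeWeight s m d
  degreeWeight-suc s m d = begin
    N * (f * u / factorial (suc d) * (s * q)) + s * (D * (f / factorial d * q))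
      ≈⟨ +-cong (*-congˡ (*-congʳ (/≈*recip (f * u) (factorial (suc d))))) (*-congˡ (*-congˡ (*-congʳ f/d!))) ⟩
    N * (f * u * inv! (suc d) * (s * q)) + s * (D * (f * inv! d * q))
      ≈⟨ +-congʳ (*-congˡ (*-congʳ (*-congˡ (inv!-suc d)))) ⟩
    N * (f * u * (inv d * inv! d) * (s * q)) + s * (D * (f * inv! d * q))
      ≈⟨ +-congʳ (solve 7 (λ N f u i j s q → N :* (f :* u :* (i :* j) :* (s :* q)) := N :* i :* (s :* u :* (f :* j :* q))) refl
           N f u (inv d) (inv! d) s q) ⟩
    N * inv d * (s * u * (f * inv! d * q)) + s * (D * (f * inv! d * q))
      ≈⟨ +-congʳ (trans (*-congʳ (inv-inverse d)) (*-identityˡ _)) ⟩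
    s * u * (f * inv! d * q) + s * (D * (f * inv! d * q))
      ≈⟨ solve 4 (λ s u D x → s :* u :* x :+ s :* (D :* x) := s :* (u :+ D) :* x) refl s u D _ ⟩
    s * (u + D) * (f * inv! d * q)
      ≈⟨ *-congʳ (*-congˡ (trans (+-assoc _ _ _) (trans (+-congˡ (-‿inverseˡ D)) (+-identityʳ m)))) ⟩
    s * m * (f * inv! d * q)
      ≈⟨ *-congˡ (*-congʳ f/d!) ⟨
    s * m * (f / factorial d * q) ∎
    where
    N = fromℕ (suc d)
    D = fromℕ d
    u = m - D
    f = fallingFactorial m d
    q = s ^ d
    f/d! : f / factorial d ≈ f * inv! d
    f/d! = /≈*recip f (factorial d)

-- Constants inside the field of rational functions.

module RationalFunctionProperties {c ℓ₁ ℓ₂ : Level} (F : HeytingField c ℓ₁ ℓ₂) where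

  open HeytingField F
  open RationalFunctions F
  private
    module P = CommutativeRing polynomialRing

  const-cong : ∀ {a b} → a ≈ b → const a ≈ᶠ const b
  const-cong {a} {b} e = cross (*ₚ-cong {a ∷ []} {b ∷ []} {1ₚ} {1ₚ} (pointwise λ { zero → e ; (suc k) → refl }) ≈ₚ-refl)

  const-0 : const 0# ≈ᶠ 0ᶠ
  const-0 = cross (*ₚ-cong {0# ∷ []} {0ₚ} {1ₚ} {1ₚ} (pointwise λ { zero → refl ; (suc k) → refl }) ≈ₚ-refl)

  const-+ : ∀ a b → const (a + b) ≈ᶠ const a +ᶠ const b
  const-+ a b = cross (*ₚ-cong {a + b ∷ []} {(a ∷ []) *ₚ 1ₚ +ₚ (b ∷ []) *ₚ 1ₚ} {1ₚ *ₚ 1ₚ} {1ₚ}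
    (P.sym (+ₚ-cong (*ₚ-identityʳ (a ∷ [])) (*ₚ-identityʳ (b ∷ [])))) (*ₚ-identityʳ 1ₚ))

  const-* : ∀ a b → const (a * b) ≈ᶠ const a *ᶠ const b
  const-* a b = cross (*ₚ-cong {a * b ∷ []} {(a ∷ []) *ₚ (b ∷ [])} {1ₚ *ₚ 1ₚ} {1ₚ}
    (pointwise λ { zero → sym (+-identityʳ _) ; (suc k) → refl }) (*ₚ-identityʳ 1ₚ))

  const-*-congˡ : ∀ a {x y} → x ≈ᶠ y → const a *ᶠ x ≈ᶠ const a *ᶠ y
  const-*-congˡ a {x} {y} = *ᶠ-cong {const a} {const a} {x} {y} ≈ᶠ-refl

  -- The proofs den#0 need not be compared.
  ≈ᶠ-ext : ∀ {x y} → num x ≡ num y → den x ≡ den y → x ≈ᶠ y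
  ≈ᶠ-ext e f = cross (P.reflexive (≡.cong₂ _*ₚ_ e (≡.sym f)))

-- The second formula over an arbitrary field extension K of ℝ, with L h in the
-- role of m z + h - 1.  The family M is separate from L ∘ hook so that it can be
-- found by unification.
module AbelHookSum {c ℓ₁ ℓ₂ c′ ℓ₁′ ℓ₂′ : Level} (R : RealNumbers c ℓ₁ ℓ₂) (K : HeytingField c′ ℓ₁′ ℓ₂′) where

  private
    module ℝ where
      open BinomialFamily R public
      open RealWeights R public
      open Division heytingField public
    open ℝ using (ℝ; weight; factorial; hookNumber)
    open HeytingField K using (_-_)
    open FieldOperations K
    CR : CommutativeRing c′ ℓ₁′
    CR = HeytingCommutativeRing.commutativeRing (HeytingField.heytingCommutativeRing K)
    open CommutativeRing CR hiding (zero; _-_)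
    open Exp commutativeSemiring using (^-congˡ; ^-distrib-*)
    open SemiringSolver commutativeSemiring using (solve; con; _:+_; _:*_; _:=_)
    open SetoidReasoning setoid
    open Division K
    open Sums CR using (∑-cong; ∏-cong; ∏-*)

  module AlongEmbedding
    (ι : ℝ → Carrier)
    (ι-cong : ∀ {x y} → x ℝ.≈ y → ι x ≈ ι y)
    (ι-0 : ι ℝ.0# ≈ 0#) (ι-1 : ι ℝ.1# ≈ 1#)
    (ι-+ : ∀ x y → ι (x ℝ.+ y) ≈ ι x + ι y)
    (ι-* : ∀ x y → ι (x ℝ.* y) ≈ ι x * ι y)
    (ι≠0 : ℝ.NonZero → NonZero) (ι≠0-value : ∀ x → proj₁ (ι≠0 x) ≈ ι (proj₁ x))
    (s m : ℝ) (z : Carrier)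
    (L : ℕ → NonZero) (L-value : ∀ h → proj₁ (L h) ≈ ι m * z + ι (ℝ.fromℕ h) - 1#)
    where

    private
      ι-^ : ∀ x n → ι (x ℝ.^ n) ≈ ι x ^ n
      ι-^ x zero    = ι-1
      ι-^ x (suc n) = trans (ι-* x _) (*-congˡ (ι-^ x n))

      ι-fromℕ : ∀ n → ι (ℝ.fromℕ n) ≈ fromℕ n
      ι-fromℕ zero    = ι-0
      ι-fromℕ (suc n) = trans (ι-+ ℝ.1# _) (+-cong ι-1 (ι-fromℕ n))

      ι-∏ : ∀ {A : Set} (xs : List A) f → ι (ℝ.∏ xs f) ≈ ∏ xs (ι ∘ f)
      ι-∏ []       f = ι-1
      ι-∏ (x ∷ xs) f = trans (ι-* (f x) _) (*-congˡ (ι-∏ xs f))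

      ι-inverse : ∀ {x y} → x ℝ.* y ℝ.≈ ℝ.1# → ι x * ι y ≈ 1#
      ι-inverse e = trans (sym (ι-* _ _)) (trans (ι-cong e) ι-1)

      ι-recip : ∀ x → recip (ι≠0 x) ≈ ι (ℝ.recip x)
      ι-recip x = recip-unique (ι≠0 x) (trans (*-congʳ (ι≠0-value x)) (ι-inverse (ℝ.recip-inverse x)))

      b inv inv! φ : ℕ → Carrier
      b d = ι (ℝ.degreeWeight s m d)
      inv  = ι ∘ ℝ.inv
      inv! = ι ∘ ℝ.inv!
      -- A default value: hook lengths are positive. In the next line the exponent -1 has turned the
      -- denominator into a factor.
      φ zero    = 1#
      φ (suc zero)    = inv 0 * (ι m * z)
      φ (suc (suc k)) = (z + fromℕ (suc (suc k))) ^ suc k * (inv (suc k) * recip (L (suc (suc k))) ^ k)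

      inv-inverse : ∀ n → fromℕ (suc n) * inv n ≈ 1#
      inv-inverse n = trans (*-congʳ (sym (ι-fromℕ (suc n)))) (ι-inverse (ℝ.inv-inverse n))

      b-suc : ∀ d → fromℕ (suc d) * b (suc d) + ι s * (fromℕ d * b d) ≈ ι s * ι m * b d
      b-suc d = begin
        fromℕ (suc d) * b (suc d) + ι s * (fromℕ d * b d)
          ≈⟨ +-cong (*-congʳ (ι-fromℕ (suc d))) (*-congˡ (*-congʳ (ι-fromℕ d))) ⟨
        ι (ℝ.fromℕ (suc d)) * b (suc d) + ι s * (ι (ℝ.fromℕ d) * b d)
          ≈⟨ trans (ι-+ _ _) (+-cong (ι-* _ _) (trans (ι-* _ _) (*-congˡ (ι-* _ _)))) ⟨
        ι (ℝ.fromℕ (suc d) ℝ.* ℝ.degreeWeight s m (suc d) ℝ.+ s ℝ.* (ℝ.fromℕ d ℝ.* ℝ.degreeWeight s m d))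
          ≈⟨ ι-cong (ℝ.degreeWeight-suc s m d) ⟩
        ι (s ℝ.* m ℝ.* ℝ.degreeWeight s m d)
          ≈⟨ trans (ι-* _ _) (*-congʳ (ι-* s m)) ⟩
        ι s * ι m * b d ∎

      L-suc : ∀ n → proj₁ (L (suc n)) ≈ ι m * z + fromℕ n
      L-suc n = begin
        proj₁ (L (suc n))                          ≈⟨ L-value (suc n) ⟩
        ι m * z + ι (ℝ.fromℕ (suc n)) - 1#         ≈⟨ +-congʳ (+-congˡ (ι-fromℕ (suc n))) ⟩
        ι m * z + (1# + fromℕ n) + - 1#            ≈⟨ solve 4 (λ x N u v → x :+ (u :+ N) :+ v := x :+ N :+ (u :+ v)) refl (ι m * z) (fromℕ n) 1# (- 1#) ⟩
        ι m * z + fromℕ n + (1# - 1#)              ≈⟨ trans (+-congˡ (-‿inverseʳ 1#)) (+-identityʳ _) ⟩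
        ι m * z + fromℕ n                          ∎

      -- Stated for a variable `h`, which allows the split into `h = 1`, with exponent -1, and
      -- `h ≥ 2`, with a natural exponent.
      φ-hook : ∀ h h≠0 M → proj₁ M ≈ proj₁ (L h) →
               (z + ι (ℝ.fromℕ h)) ^ (h ∸ 1) / (ι≠0 (ℝ.fromℕ-nonZero h h≠0) ⊗ M ^ℤ (h ⊖ 2)) ≈ φ h
      φ-hook h h≠0 M M≈L = begin
        (z + ι (ℝ.fromℕ h)) ^ (h ∸ 1) / (H ⊗ M ^ℤ (h ⊖ 2))
          ≈⟨ /≈*recip ((z + ι (ℝ.fromℕ h)) ^ (h ∸ 1)) (H ⊗ M ^ℤ (h ⊖ 2)) ⟩
        (z + ι (ℝ.fromℕ h)) ^ (h ∸ 1) * recip (H ⊗ M ^ℤ (h ⊖ 2))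
          ≈⟨ *-cong (^-congˡ (h ∸ 1) (+-congˡ (ι-fromℕ h)))
                    (trans (recip-⊗ H (M ^ℤ (h ⊖ 2))) (*-congʳ (ι-recip (ℝ.fromℕ-nonZero h h≠0)))) ⟩
        (z + fromℕ h) ^ (h ∸ 1) * (ι (ℝ.recip (ℝ.fromℕ-nonZero h h≠0)) * recip (M ^ℤ (h ⊖ 2)))
          ≈⟨ cases h h≠0 M≈L ⟩
        φ h ∎
        where
        H = ι≠0 (ℝ.fromℕ-nonZero h h≠0)
        cases : ∀ h h≠0 → proj₁ M ≈ proj₁ (L h) →
                (z + fromℕ h) ^ (h ∸ 1) * (ι (ℝ.recip (ℝ.fromℕ-nonZero h h≠0)) * recip (M ^ℤ (h ⊖ 2))) ≈ φ h
        cases 1 _ M≈L = trans (*-identityˡ _)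
          (*-congˡ (trans (recip-^ℤ-neg M ≡.refl) (trans M≈L (trans (L-suc 0) (+-identityʳ _)))))
        cases (suc (suc k)) _ M≈L = *-congˡ (*-congˡ
          (trans (recip-^ℤ-pos M k ≡.refl) (^-congˡ k (recip-cong M (L (suc (suc k))) M≈L))))

      open HookFormulas.ForWeights CR inv inv-inverse inv! (trans (ι-cong ℝ.inv!-zero) ι-1)
        (λ n → trans (ι-cong (ℝ.inv!-suc n)) (ι-* _ _))
        b (trans (ι-cong (ℝ.degreeWeight-zero s m)) ι-1) (ι s) (ι m) b-suc φ

    module _ (M : Tree → NonZero) where

      hookFactor : Tree → Carrier
      hookFactor v = (z + ι (ℝ.fromℕ (hook v))) ^ (hook v ∸ 1) / (ι≠0 (hookNumber v) ⊗ M v ^ℤ (hook v ⊖ 2))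

      abel-hookSum : (∀ v → proj₁ (M v) ≈ proj₁ (L (hook v))) → ∀ n → 1 ≤ n →
        ∑ (orderedTrees n) (λ T → ι (weight s m T) * ∏ (vertices T) hookFactor)
          ≈ ι (s ℝ.^ (n ∸ 1) ℝ.* m ℝ.^ n) * z / ι≠0 (factorial n) * (z + ι (ℝ.fromℕ n)) ^ (n ∸ 1)
      abel-hookSum M≈L (suc n) _ = begin
        ∑ (orderedTrees (suc n)) (λ T → ι (weight s m T) * ∏ (vertices T) hookFactor)
          ≈⟨ ∑-cong (orderedTrees (suc n)) (λ T → *-cong (ι-∏ (vertices T) _)
               (∏-cong (vertices T) λ v → φ-hook (hook v) (hook-nonZero v) (M v) (M≈L v))) ⟩
        ∑ (orderedTrees (suc n)) (λ T → ∏ (vertices T) (λ v → b (degree v)) * ∏ (vertices T) (λ v → φ (hook v)))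
          ≈⟨ ∑-cong (orderedTrees (suc n)) (λ T → ∏-* (vertices T) _ _) ⟨
        ∑ (orderedTrees (suc n)) (λ T → ∏ (vertices T) λ v → b (degree v) * φ (hook v))
          -- Hook length `k + 2` has `m z + h - 1` equal to `m z + (k + 1)`, hence the shift by two.
          ≈⟨ abel-hookFormula z (λ k → recip (L (suc (suc k))))
               (λ k → trans (*-comm _ _) (trans (*-congʳ (sym (L-suc (suc k)))) (recip-inverse (L (suc (suc k)))))) refl (λ _ → refl) n ⟩
        (ι s * ι m) ^ n * ι m * z * inv! (suc n) * (z + fromℕ (suc n)) ^ n
          ≈⟨ *-cong (trans (*-cong (*-congʳ constant) (sym (ι-recip (factorial (suc n)))))
                           (sym (/≈*recip (ι (s ℝ.^ n ℝ.* m ℝ.^ suc n) * z) (ι≠0 (factorial (suc n))))))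
                    (^-congˡ n (+-congˡ (sym (ι-fromℕ (suc n))))) ⟩
        ι (s ℝ.^ n ℝ.* m ℝ.^ suc n) * z / ι≠0 (factorial (suc n)) * (z + ι (ℝ.fromℕ (suc n))) ^ n ∎
        where
        constant : (ι s * ι m) ^ n * ι m ≈ ι (s ℝ.^ n ℝ.* m ℝ.^ suc n)
        constant = begin
          (ι s * ι m) ^ n * ι m     ≈⟨ *-congʳ (^-distrib-* (ι s) (ι m) n) ⟩
          ι s ^ n * ι m ^ n * ι m   ≈⟨ trans (*-assoc _ _ _) (*-congˡ (*-comm _ _)) ⟩
          ι s ^ n * ι m ^ suc n     ≈⟨ *-cong (ι-^ s n) (ι-^ m (suc n)) ⟨
          ι (s ℝ.^ n) * ι (m ℝ.^ suc n) ≈⟨ ι-* _ _ ⟨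
          ι (s ℝ.^ n ℝ.* m ℝ.^ suc n) ∎

-- The first formula over the reals.

module ExponentialHookSum {c ℓ₁ ℓ₂ : Level} (R : RealNumbers c ℓ₁ ℓ₂) where

  open BinomialFamily R
  open RealWeights R
  open SetoidReasoning (CommutativeRing.setoid ring)
  open Division heytingField
  open Sums ring using (∑-cong; ∏-cong; ∏-*)

  exponential-hookSum : ∀ s m (m≠0 : NonZero) → proj₁ m≠0 ≈ m → ∀ n → 1 ≤ n →
    ∑ (orderedTrees n) (λ T →
        weight s m T * ∏ (vertices T) (λ v → 1# / (hookNumber v ⊗ m≠0 ^ℕ (hook v ∸ 1))))
      ≈ s ^ (n ∸ 1) / factorial n
  exponential-hookSum s m m≠0 m≈ (suc n) _ = begin
    ∑ (orderedTrees (suc n)) (λ T → weight s m T * ∏ (vertices T) hookFactor)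
      ≈⟨ ∑-cong (orderedTrees (suc n)) (λ T →
           trans (sym (∏-* (vertices T) _ _)) (∏-cong (vertices T) λ v → *-congˡ (φ-hook v))) ⟩
    ∑ (orderedTrees (suc n)) (λ T → ∏ (vertices T) λ v → degreeWeight s m (degree v) * φ (hook v))
      ≈⟨ exponential-hookFormula (recip m≠0) (trans (*-comm _ _) (trans (*-cong (sym m≈) refl) (recip-inverse m≠0))) (λ _ → refl) n ⟩
    s ^ n * inv! (suc n)
      ≈⟨ /≈*recip (s ^ n) (factorial (suc n)) ⟨
    s ^ n / factorial (suc n) ∎
    where
    φ : ℕ → ℝ
    φ zero    = 1#
    φ (suc n) = inv n * recip m≠0 ^ n
    hookFactor : Tree → ℝ
    hookFactor v = 1# / (hookNumber v ⊗ m≠0 ^ℕ (hook v ∸ 1))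
    φ-hook : ∀ v → hookFactor v ≈ φ (hook v)
    -- Matching on `node` exposes the hook length as a successor, so that `φ` computes.
    φ-hook v@(node ts) = trans (trans (/≈*recip 1# (hookNumber v ⊗ m≠0 ^ℕ (hook v ∸ 1))) (*-identityˡ _))
      (trans (recip-⊗ (hookNumber v) (m≠0 ^ℕ (hook v ∸ 1))) (*-congˡ (recip-^ℕ m≠0 (hook v ∸ 1))))
    open HookFormulas.ForWeights ring inv inv-inverse inv! inv!-zero inv!-suc
      (degreeWeight s m) (degreeWeight-zero s m) s m (degreeWeight-suc s m) φ

theorem1 : ∀ {c ℓ₁ ℓ₂} (R : RealNumbers c ℓ₁ ℓ₂) →
    let open BinomialFamily R in
    (s m : ℝ) (0<sm : 0# < s * m) → (0# < s → ∃[ k ] 1 ≤ k × m ≈ fromℕ k) →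
    let m≠0 = rightFactor s m 0<sm in
    ∀ n → 1 ≤ n →
    ∑ (orderedTrees n) (λ T →
    weight s m T *
    ∏ (vertices T) (λ v → 1# / (hookNumber v ⊗ m≠0 ^ℕ (hook v ∸ 1))))
    ≈ s ^ (n ∸ 1) / factorial n
    ×
    ∑ᶠ (orderedTrees n) (λ T →
    const (weight s m T) *ᶠ
    ∏ᶠ (vertices T) (λ v →
    (z +ᶠ const (fromℕ (hook v))) ^ᶠ (hook v ∸ 1)
    /ᶠ (constNonZero (hookNumber v) ⊗ᶠ linear m≠0 (hook v) ^ℤᶠ (hook v ⊖ 2))))
    ≈ᶠ const (s ^ (n ∸ 1) * m ^ n) *ᶠ z /ᶠ constNonZero (factorial n)
    *ᶠ (z +ᶠ const (fromℕ n)) ^ᶠ (n ∸ 1)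
-- The summands are compared factor by factor, with M read off the goal: a direct
-- comparison would unfold the apartness proofs inside the fractions.
theorem1 R s m 0<sm _ n 1≤n = exponential-hookSum s m m≠0 refl n 1≤n ,
  (let M : Tree → NonZeroᶠ
       M = _
   in ≈ᶠ-trans
     (∑-cong (orderedTrees n) λ T → const-*-congˡ (weight s m T) (∏-cong (vertices T) λ v →
       ≈ᶠ-ext {y = hookFactor M v} ≡.refl ≡.refl))
     (≈ᶠ-trans (abel-hookSum M (λ v → ≈ᶠ-ext ≡.refl ≡.refl) n 1≤n) (≈ᶠ-ext ≡.refl ≡.refl)))
  where
  open BinomialFamily R
  open RationalFunctionProperties heytingField
  open ExponentialHookSum R
  m≠0 : NonZero
  m≠0 = rightFactor s m 0<sm
  const≠0-value : ∀ a → proj₁ (constNonZero a) ≈ᶠ const (proj₁ a)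
  const≠0-value (a , _) = ≈ᶠ-refl {const a}
  linear-value : ∀ a h → proj₁ (linear a h) ≈ᶠ const (proj₁ a) *ᶠ z +ᶠ const (fromℕ h) -ᶠ 1ᶠ
  linear-value (a , _) h = ≈ᶠ-refl {const a *ᶠ z +ᶠ const (fromℕ h) -ᶠ 1ᶠ}
  open AbelHookSum.AlongEmbedding R rationalFunctionField const const-cong const-0 (≈ᶠ-refl {1ᶠ}) const-+ const-*
    constNonZero const≠0-value s m z (linear m≠0) (linear-value m≠0)
  open Sums (HeytingCommutativeRing.commutativeRing (HeytingField.heytingCommutativeRing rationalFunctionField))
    using (∑-cong; ∏-cong)
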